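{- For $n\ge 0$ define $$U_{n}(q,b,q):=\frac{(1-q^{4n+2})(q/b;q)_n(-b)^nq^{n(n-1)/2}}{q^n(1-b)(1-q^2)(bq;q)_n}\left(1+2\sum_{j=1}^{n}\frac{(b;q)_j}{(q/b;q)_j}b^{ -j}q^{j(j+1)/2}\right),$$ and let $U_n(q,-b,q)$ be the expression obtained by replacing $b$ by $-b$ throughout. Put $$U_{1(n)}(q^2,b,q^2)=\tfrac{1}{2}U_{n}(q,b,q)+\tfrac{1}{2}U_{n}(q,-b,q),\qquad U_{2(n)}(q^2,b,q^2)=\frac{(-b^2)^nq^{n(n-2)}}{(-q;q)_{2n}(b^2;q^2)_{n+1}}.$$ Then $(U_{1(n)}(q^2,b,q^2),U_{2(n)}(q^2,b,q^2))$ is a Bailey pair with respect to $(q^2,q^2)$; that is, for all $n\ge 0$, $$U_{2(n)}(q^2,b,q^2)=\sum_{j=0}^{n}\frac{U_{1(j)}(q^2,b,q^2)}{(q^2;q^2)_{n-j}(q^4;q^2)_{n+j}}.$$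
   Context: Here $(z;q)_n=(1-z)(1-zq)\cdots(1-zq^{n-1})$ (with $(z;q)_0=1$), and likewise with base $q^2$. The parameter $q\in\mathbb{C}$ satisfies $0<|q|<1$, and $b\in\mathbb{C}$, $b\neq 0$, is such that no denominator occurring in the formulas vanishes. A pair of sequences $(\alpha_n(a,q),\beta_n(a,q))$ is a Bailey pair with respect to $(a,q)$ if $\beta_n(a,q)=\sum_{0\le j\le n}\frac{\alpha_j(a,q)}{(q;q)_{n-j}(aq;q)_{n+j}}$ for all $n\ge 0$; a Bailey pair with respect to $(q^2,q^2)$ is obtained by taking $a=q^2$ and base $q^2$ in place of $q$. -}

module Defs where

open import Level using (0ℓ; _⊔_)
import Algebra.Bundles
open import Algebra.Structures using (IsCommutativeRing)
open import Algebra.Apartness.Structures using (IsHeytingField)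
open import Algebra.Apartness.Bundles using (HeytingCommutativeRing; HeytingField)
import Algebra.Apartness.Properties.HeytingCommutativeRing
import Algebra.Properties.Ring
import Algebra.Properties.Semiring.Exp
import Algebra.Properties.Semiring.Sum
open import Data.Bool.Base using (if_then_else_)
open import Data.Nat.Base as ℕ using (ℕ; zero; suc)
import Data.Nat.DivMod as ℕ
import Data.Nat.Properties as ℕₚ
open import Data.Integer.Base as ℤ using (ℤ; +_; -[1+_])
import Data.Integer.Properties as ℤₚ
open import Data.Fin.Base using (Fin; toℕ)
open import Data.Product.Base using (∃-syntax; _×_; _,_; proj₁; proj₂)
open import Data.Sum.Base as Sum using (_⊎_; inj₁; inj₂)
open import Data.Empty using (⊥-elim)
open import Relation.Nullary.Negation using (¬_)
open import Relation.Nullary.Decidable using (Dec; ⌊_⌋; yes; no)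

-- Division and nonvanishing are constructive: x / y needs y apart from 0.
module QSeries {c ℓ₁ ℓ₂} (K : HeytingField c ℓ₁ ℓ₂) where

  open HeytingField K
  open HeytingCommutativeRing heytingCommutativeRing using (commutativeRing)
  open Algebra.Bundles.CommutativeRing commutativeRing using (ring; semiring)
  open Algebra.Properties.Semiring.Exp semiring public using (_^_)
  open Algebra.Properties.Semiring.Exp semiring using (^-assocʳ)
  open Algebra.Properties.Semiring.Sum semiring using (sum)
  open Algebra.Properties.Ring ring using (-‿distribˡ-*; -‿distribʳ-*; -‿involutive)
  open Algebra.Apartness.Properties.HeytingCommutativeRing heytingCommutativeRing
    using (x-0≈x; 1#0; x#0y#0→xy#0; #-congʳ; invertibleʳ⇒#)

  inverse : ∀ x → x # 0# → Carrier
  inverse x x#0 = proj₁ (#⇒invertible x#0)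

  infixl 7 _/_⟨_⟩
  _/_⟨_⟩ : ∀ x y → y # 0# → Carrier
  x / y ⟨ y#0 ⟩ = x * inverse y y#0

  infixr 8 _^⟨_⟩_
  _^⟨_⟩_ : ∀ x → x # 0# → ℤ → Carrier
  x ^⟨ x#0 ⟩ (+ n)    = x ^ n
  x ^⟨ x#0 ⟩ -[1+ n ] = inverse x x#0 ^ suc n

  -- (z ; p)ₙ
  poch : Carrier → Carrier → ℕ → Carrier
  poch z p zero    = 1#
  poch z p (suc n) = poch z p n * (1# - z * p ^ n)

  -- The nonvanishing proofs are opaque only so that terms containing them
  -- compare quickly.
  opaque
    *#0 : ∀ {x y} → x # 0# → y # 0# → x * y # 0#
    *#0 = x#0y#0→xy#0

  -- Bailey pair with respect to (a , p); p is the base, and n ∸ j is exact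
  -- since j ≤ n.
  IsBaileyPair : (a p : Carrier) →
                 (∀ n → poch p p n # 0#) → (∀ n → poch (a * p) p n # 0#) →
                 (α β : ℕ → Carrier) → Set ℓ₁
  IsBaileyPair a p p#0 ap#0 α β = ∀ n →
    β n ≈ sum {suc n} λ i → let j = toℕ i in
      α j / (poch p p (n ℕ.∸ j) * poch (a * p) p (n ℕ.+ j))
        ⟨ *#0 (p#0 (n ℕ.∸ j)) (ap#0 (n ℕ.+ j)) ⟩

  opaque
    ^#0 : ∀ {x} → x # 0# → ∀ n → x ^ n # 0#
    ^#0 x#0 zero    = 1#0
    ^#0 x#0 (suc n) = *#0 x#0 (^#0 x#0 n)

    poch#0 : ∀ {z p} → (∀ i → 1# - z * p ^ i # 0#) → ∀ n → poch z p n # 0#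
    poch#0 h zero    = 1#0
    poch#0 h (suc n) = *#0 (poch#0 h n) (h n)

    -#0 : ∀ {x} → x # 0# → - x # 0#
    -#0 {x} x#0 with #⇒invertible x#0
    ... | y , _ , [x-0]y≈1 = invertibleʳ⇒# (- y ,
      trans (*-congʳ (x-0≈x (- x))) (trans (sym (-‿distribˡ-* x (- y)))
        (trans (-‿cong (sym (-‿distribʳ-* x y))) (trans (-‿involutive (x * y))
          (trans (*-congʳ (sym (x-0≈x x))) [x-0]y≈1)))))

  -- All denominators in q alone are nonzero; for 0 < |q| < 1 this is
  -- punctured-disc below, not an assumption.
  record IsBase (q : Carrier) : Set ℓ₂ where
    field
      q#0    : q # 0#
      1-qᵏ#0 : ∀ k → 1# - q ^ suc k # 0#
      1+qᵏ#0 : ∀ k → 1# + q ^ suc k # 0#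

  -- The denominators of  Uₙ(q,b,q)  that involve b.
  record UDenominators (q b : Carrier) (b#0 : b # 0#) : Set ℓ₂ where
    field
      1-b#0    : 1# - b # 0#
      [bq]ₙ#0  : ∀ n → poch (b * q) q n # 0#
      [q/b]ₙ#0 : ∀ n → poch (q / b ⟨ b#0 ⟩) q n # 0#

  record NoDenominatorVanishes (q b : Carrier) (b#0 : b # 0#) : Set ℓ₂ where
    field
      at-b       : UDenominators q b b#0
      at-minus-b : UDenominators q (- b) (-#0 b#0)
      [b²]ₙ₊₁#0  : ∀ n → poch (b ^ 2) (q ^ 2) (suc n) # 0#

  module _ {q : Carrier} (base : IsBase q) where
    open IsBase base

    opaque
      1-[q²]ᵏ#0 : ∀ k → 1# - (q ^ 2) ^ suc k # 0#
      1-[q²]ᵏ#0 k = #-congʳ (+-congˡ (-‿cong (sym (^-assocʳ q 2 (suc k))))) (1-qᵏ#0 (k ℕ.+ 1 ℕ.* suc k))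

      [q²]ₙ#0 : ∀ n → poch (q ^ 2) (q ^ 2) n # 0#
      [q²]ₙ#0 = poch#0 1-[q²]ᵏ#0

      [q⁴]ₙ#0 : ∀ n → poch (q ^ 2 * q ^ 2) (q ^ 2) n # 0#
      [q⁴]ₙ#0 = poch#0 λ i →
        #-congʳ (+-congˡ (-‿cong (sym (*-assoc (q ^ 2) (q ^ 2) ((q ^ 2) ^ i))))) (1-[q²]ᵏ#0 (suc i))

      [-q]ₙ#0 : ∀ n → poch (- q) q n # 0#
      [-q]ₙ#0 = poch#0 λ i → #-congʳ
        (+-congˡ (trans (sym (-‿involutive (q * q ^ i))) (-‿cong (-‿distribˡ-* q (q ^ i)))))
        (1+qᵏ#0 i)

    -- The ℕ-divisions by 2 in the exponents are exact.
    U : (b : Carrier) (b#0 : b # 0#) → UDenominators q b b#0 → ℕ → Carrier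
    U b b#0 d n =
      (1# - q ^ (4 ℕ.* n ℕ.+ 2)) * poch q/b q n * (- b) ^ n * q ^ (n ℕ.* (n ℕ.∸ 1) ℕ./ 2)
        / (q ^ n * (1# - b) * (1# - q ^ 2) * poch (b * q) q n)
        ⟨ *#0 (*#0 (*#0 (^#0 q#0 n) 1-b#0) (1-qᵏ#0 1)) ([bq]ₙ#0 n) ⟩
      * (1# + (1# + 1#) * sum {n} λ i → let j = suc (toℕ i) in
          poch b q j / poch q/b q j ⟨ [q/b]ₙ#0 j ⟩
          * b ^⟨ b#0 ⟩ (ℤ.- + j) * q ^ (j ℕ.* (j ℕ.+ 1) ℕ./ 2))
      where
      open UDenominators d
      q/b = q / b ⟨ b#0 ⟩

    module _ {b : Carrier} {b#0 : b # 0#} (nz : NoDenominatorVanishes q b b#0) where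
      open NoDenominatorVanishes nz

      U₁ : 1# + 1# # 0# → ℕ → Carrier
      U₁ 2#0 n = ½ * U b b#0 at-b n + ½ * U (- b) (-#0 b#0) at-minus-b n
        where
        ½ = 1# / (1# + 1#) ⟨ 2#0 ⟩

      U₂ : ℕ → Carrier
      U₂ n = (- (b ^ 2)) ^ n * q ^⟨ q#0 ⟩ (+ n ℤ.* (+ n ℤ.- + 2))
             / (poch (- q) q (2 ℕ.* n) * poch (b ^ 2) (q ^ 2) (suc n))
             ⟨ *#0 ([-q]ₙ#0 (2 ℕ.* n)) ([b²]ₙ₊₁#0 n) ⟩

open import Relation.Binary.PropositionalEquality
open import Data.Rational.Base as ℚ
  using (ℚ; mkℚ; 0ℚ; 1ℚ; ½; _+_; _*_; -_; _-_; _≤_; _<_; ∣_∣)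
import Data.Rational.Properties as ℚₚ
import Data.Rational.Unnormalised.Base as ℚᵘ
import Data.Rational.Unnormalised.Properties as ℚᵘₚ
open import Data.Rational.Solver using (module +-*-Solver)
open +-*-Solver using (solve; con; _:=_; _:+_; _:*_; :-_; _:-_)

cert : ∀ {p q} r → 0ℚ ≤ r → q - p ≡ r → p ≤ q
cert {p} {q} r 0≤r eq = subst₂ _≤_ (ℚₚ.+-identityˡ p)
  (trans (cong (_+ p) (sym eq)) (solve 2 (λ p q → (q :- p) :+ p := q) refl p q))
  (ℚₚ.+-monoˡ-≤ p 0≤r)

0≤-diff : ∀ {p q} → p ≤ q → 0ℚ ≤ q - p
0≤-diff {p} {q} p≤q = subst (_≤ q - p) (ℚₚ.+-inverseʳ p) (ℚₚ.+-monoˡ-≤ (- p) p≤q)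

0≤+ : ∀ {p q} → 0ℚ ≤ p → 0ℚ ≤ q → 0ℚ ≤ p + q
0≤+ = ℚₚ.+-mono-≤

0≤* : ∀ {p q} → 0ℚ ≤ p → 0ℚ ≤ q → 0ℚ ≤ p * q
0≤* {p} {q} 0≤p 0≤q = subst (_≤ p * q) (ℚₚ.*-zeroʳ p)
  (ℚₚ.*-monoˡ-≤-nonNeg p {{ℚ.nonNegative 0≤p}} 0≤q)

0<* : ∀ {p q} → 0ℚ < p → 0ℚ < q → 0ℚ < p * q
0<* {p} {q} 0<p 0<q = subst (_< p * q) (ℚₚ.*-zeroʳ p)
  (ℚₚ.*-monoʳ-<-pos p {{ℚ.positive 0<p}} 0<q)

0<1 : 0ℚ < 1ℚ
0<1 = ℚₚ.positive⁻¹ 1ℚ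

0<½ : 0ℚ < ½
0<½ = ℚₚ.positive⁻¹ ½

0≤½ : 0ℚ ≤ ½
0≤½ = ℚₚ.<⇒≤ 0<½

0<half : ∀ {ε} → 0ℚ < ε → 0ℚ < ½ * ε
0<half = 0<* 0<½

0≤sq : ∀ p → 0ℚ ≤ p * p
0≤sq p with ℚₚ.≤-total 0ℚ p
... | inj₁ 0≤p = 0≤* 0≤p 0≤p
... | inj₂ p≤0 = subst (0ℚ ≤_) (solve 1 (λ p → (con 0ℚ :- p) :* (con 0ℚ :- p) := p :* p) refl p)
                   (0≤* (0≤-diff p≤0) (0≤-diff p≤0))

p≤∣p∣ : ∀ p → p ≤ ∣ p ∣
p≤∣p∣ p with ℚₚ.≤-total 0ℚ p
... | inj₁ 0≤p = ℚₚ.≤-reflexive (sym (ℚₚ.0≤p⇒∣p∣≡p 0≤p))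
... | inj₂ p≤0 = ℚₚ.≤-trans p≤0 (ℚₚ.0≤∣p∣ p)

∣-∣-sym : ∀ p q → ∣ p - q ∣ ≡ ∣ q - p ∣
∣-∣-sym p q = trans (sym (ℚₚ.∣-p∣≡∣p∣ (p - q)))
  (cong ∣_∣ (solve 2 (λ p q → :- (p :- q) := q :- p) refl p q))

∣∣≤ : ∀ p q {ε} → p ≤ q + ε → q ≤ p + ε → ∣ p - q ∣ ≤ ε
∣∣≤ p q {ε} h k with ℚₚ.∣p∣≡p∨∣p∣≡-p (p - q)
... | inj₁ eq = subst (_≤ ε) (sym eq) (cert _ (0≤-diff h)
      (solve 3 (λ p q ε → ε :- (p :- q) := (q :+ ε) :- p) refl p q ε))
... | inj₂ eq = subst (_≤ ε) (sym eq) (cert _ (0≤-diff k)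
      (solve 3 (λ p q ε → ε :- (:- (p :- q)) := (p :+ ε) :- q) refl p q ε))

≤+ : ∀ p q {ε} → ∣ p - q ∣ ≤ ε → p ≤ q + ε
≤+ p q {ε} h = cert _ (0≤-diff (ℚₚ.≤-trans (p≤∣p∣ (p - q)) h))
  (solve 3 (λ p q ε → (q :+ ε) :- p := ε :- (p :- q)) refl p q ε)

≥- : ∀ p q {ε} → ∣ p - q ∣ ≤ ε → q ≤ p + ε
≥- p q {ε} h = ≤+ q p (subst (_≤ ε) (∣-∣-sym p q) h)

reciprocal : ∀ p → 0ℚ < p → ∃[ r ] 0ℚ < r × p * r ≡ 1ℚ
reciprocal p 0<p = ℚ.1/ p , ℚₚ.positive⁻¹ _ {{ℚₚ.1/pos⇒pos p}} , ℚₚ.*-inverseʳ p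
  where instance
    pos : ℚ.Positive p
    pos = ℚ.positive 0<p
    nz : ℚ.NonZero p
    nz = ℚₚ.pos⇒nonZero p

*-mono : ∀ {a b c d} → 0ℚ ≤ a → 0ℚ ≤ d → a ≤ b → c ≤ d → a * c ≤ b * d
*-mono {a} {b} {c} {d} 0≤a 0≤d a≤b c≤d =
  cert _ (0≤+ (0≤* 0≤a (0≤-diff c≤d)) (0≤* 0≤d (0≤-diff a≤b)))
    (solve 4 (λ a b c d → b :* d :- a :* c := a :* (d :- c) :+ d :* (b :- a)) refl a b c d)

cert< : ∀ {p q} r → 0ℚ < r → q - p ≡ r → p < q
cert< {p} {q} r 0<r eq = subst₂ _<_ (ℚₚ.+-identityˡ p)
  (trans (cong (_+ p) (sym eq)) (solve 2 (λ p q → (q :- p) :+ p := q) refl p q))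
  (ℚₚ.+-monoˡ-< p 0<r)

0<-diff : ∀ {p q} → p < q → 0ℚ < q - p
0<-diff {p} {q} p<q = subst (_< q - p) (ℚₚ.+-inverseʳ p) (ℚₚ.+-monoˡ-< (- p) p<q)

≤⇒≯ : ∀ {p q} → p ≤ q → ¬ (q < p)
≤⇒≯ p≤q q<p = ℚₚ.<-irrefl refl (ℚₚ.<-≤-trans q<p p≤q)

sq-cancel-≤ : ∀ {p q} → 0ℚ ≤ q → p * p ≤ q * q → p ≤ q
sq-cancel-≤ {p} {q} 0≤q h with p ℚₚ.≤? q
... | yes p≤q = p≤q
... | no p≰q = ⊥-elim (≤⇒≯ h (cert< _
    (ℚₚ.+-mono-<-≤ (0<* 0<d 0<d) (0≤+ (0≤* 0≤q (ℚₚ.<⇒≤ 0<d)) (0≤* 0≤q (ℚₚ.<⇒≤ 0<d))))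
    (solve 2 (λ p q → p :* p :- q :* q := (p :- q) :* (p :- q) :+ (q :* (p :- q) :+ q :* (p :- q))) refl p q)))
  where
  0<d : 0ℚ < p - q
  0<d = 0<-diff (ℚₚ.≰⇒> p≰q)

ι : ℕ → ℚ
ι zero    = 0ℚ
ι (suc n) = 1ℚ + ι n

0≤ι : ∀ n → 0ℚ ≤ ι n
0≤ι zero    = ℚₚ.≤-refl
0≤ι (suc n) = 0≤+ (ℚₚ.<⇒≤ 0<1) (0≤ι n)

ι-mono : ∀ {m n} → m ℕ.≤ n → ι m ≤ ι n
ι-mono {n = n} ℕ.z≤n = 0≤ι n
ι-mono (ℕ.s≤s m≤n)   = ℚₚ.+-monoʳ-≤ 1ℚ (ι-mono m≤n)

toℚᵘ-ι : ∀ n → ℚ.toℚᵘ (ι n) ℚᵘ.≃ ℚᵘ.mkℚᵘ (+ n) 0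
toℚᵘ-ι zero    = ℚᵘₚ.≃-refl
toℚᵘ-ι (suc n) = ℚᵘₚ.≃-trans (ℚₚ.toℚᵘ-homo-+ 1ℚ (ι n))
  (ℚᵘₚ.≃-trans (ℚᵘₚ.+-congʳ (ℚ.toℚᵘ 1ℚ) (toℚᵘ-ι n))
    (ℚᵘ.*≡* (cong (ℤ._* (ℤ.+ 1)) (cong (ℤ._+_ (ℤ.+ 1)) (ℤₚ.*-identityʳ (ℤ.+ n))))))

archimedean : ∀ ε → 0ℚ < ε → ∃[ N ] 1ℚ ≤ ε * ι N
archimedean ε@(mkℚ (+ suc a) d _) _ = suc d , ℚₚ.toℚᵘ-cancel-≤
  (ℚᵘₚ.≤-trans (ℚᵘ.*≤* (ℤ.+≤+ (subst₂ ℕ._≤_ (sym lhs) (sym (ℕₚ.*-identityʳ _))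
                                          (ℕₚ.m≤m+n (suc d) (a ℕ.* suc d)))))
    (ℚᵘₚ.≤-reflexive (ℚᵘₚ.≃-sym (ℚᵘₚ.≃-trans (ℚₚ.toℚᵘ-homo-* ε (ι (suc d)))
      (ℚᵘₚ.*-congˡ {ℚ.toℚᵘ ε} (toℚᵘ-ι (suc d)))))))
  where
  lhs : 1 ℕ.* (suc d ℕ.* 1) ≡ suc d
  lhs = trans (ℕₚ.*-identityˡ _) (ℕₚ.*-identityʳ _)
archimedean (mkℚ (+ zero)  d _) (ℚ.*<* (ℤ.+<+ ()))
archimedean (mkℚ -[1+ a ] d _) (ℚ.*<* ())

½^ : ℕ → ℚ
½^ zero    = 1ℚ
½^ (suc n) = ½ * ½^ n

0≤½^ : ∀ n → 0ℚ ≤ ½^ n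
0≤½^ zero    = ℚₚ.<⇒≤ 0<1
0≤½^ (suc n) = 0≤* 0≤½ (0≤½^ n)

½^≤1 : ∀ n → ½^ n ≤ 1ℚ
½^≤1 zero    = ℚₚ.≤-refl
½^≤1 (suc n) = cert _ (0≤+ 0≤½ (0≤* 0≤½ (0≤-diff (½^≤1 n))))
  (solve 1 (λ h → con 1ℚ :- con ½ :* h := con ½ :+ con ½ :* (con 1ℚ :- h)) refl (½^ n))

½^*ι≤1 : ∀ n → ½^ n * ι n ≤ 1ℚ
½^*ι≤1 zero    = ℚₚ.<⇒≤ 0<1
½^*ι≤1 (suc n) = cert _ (0≤+ (0≤* 0≤½ (0≤-diff (½^≤1 n))) (0≤* 0≤½ (0≤-diff (½^*ι≤1 n))))
  (solve 2 (λ h i → con 1ℚ :- con ½ :* h :* (con 1ℚ :+ i)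
     := con ½ :* (con 1ℚ :- h) :+ con ½ :* (con 1ℚ :- h :* i)) refl (½^ n) (ι n))

-- With  1 ≤ ε N  and  n ≥ N:  ½ⁿ ≤ ½ⁿ ε N ≤ ε ½ⁿ n ≤ ε.
½^→0 : ∀ ε → 0ℚ < ε → ∃[ N ] (∀ n → N ℕ.≤ n → ½^ n ≤ ε)
½^→0 ε 0<ε with archimedean ε 0<ε
... | N , h = N , λ n N≤n → cert _
    (0≤+ (0≤* (0≤½^ n) (0≤-diff h))
      (0≤+ (0≤* (0≤* (0≤½^ n) 0≤ε) (0≤-diff (ι-mono N≤n))) (0≤* 0≤ε (0≤-diff (½^*ι≤1 n)))))
    (solve 4 (λ ε h N i → ε :- h
       := h :* (ε :* N :- con 1ℚ) :+ (h :* ε :* (i :- N) :+ ε :* (con 1ℚ :- h :* i)))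
       refl ε (½^ n) (ι N) (ι n))
  where
  0≤ε : 0ℚ ≤ ε
  0≤ε = ℚₚ.<⇒≤ 0<ε

Eventually : (ℕ → Set) → Set
Eventually P = ∃[ N ] (∀ n → N ℕ.≤ n → P n)

both : ∀ {P Q R : ℕ → Set} → (∀ n → P n → Q n → R n) →
       Eventually P → Eventually Q → Eventually R
both f (M , p) (N , q) = M ℕ.⊔ N , λ n h →
  f n (p n (ℕₚ.≤-trans (ℕₚ.m≤m⊔n M N) h)) (q n (ℕₚ.≤-trans (ℕₚ.m≤n⊔m M N) h))

evmap : ∀ {P Q : ℕ → Set} → (∀ n → P n → Q n) → Eventually P → Eventually Q
evmap f (N , p) = N , λ n h → f n (p n h)

-- Cauchy sequences of rationals; equality of reals is the setoid _≈ᴿ_.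
record ℝ : Set where
  field
    seq    : ℕ → ℚ
    cauchy : ∀ ε → 0ℚ < ε →
             ∃[ N ] (∀ m n → N ℕ.≤ m → N ℕ.≤ n → ∣ seq m - seq n ∣ ≤ ε)

open ℝ public

infix 4 _≈ᴿ_ _<ᴿ_
infixl 6 _+ᴿ_
infixl 7 _*ᴿ_
infix 8 -ᴿ_

_≈ᴿ_ : ℝ → ℝ → Set
x ≈ᴿ y = ∀ ε → 0ℚ < ε → Eventually (λ n → ∣ seq x n - seq y n ∣ ≤ ε)

_<ᴿ_ : ℝ → ℝ → Set
x <ᴿ y = ∃[ ε ] 0ℚ < ε × Eventually (λ n → seq x n + ε ≤ seq y n)

one-sided : ∀ {s : ℕ → ℚ} {ε} →
  Eventually (λ N → ∀ m n → N ℕ.≤ m → N ℕ.≤ n → s m ≤ s n + ε) →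
  ∃[ N ] (∀ m n → N ℕ.≤ m → N ℕ.≤ n → ∣ s m - s n ∣ ≤ ε)
one-sided {s} (N , h) = N , λ m n p q →
  ∣∣≤ (s m) (s n) (h N ℕₚ.≤-refl m n p q) (h N ℕₚ.≤-refl n m q p)

constᴿ : ℚ → ℝ
constᴿ p = record
  { seq    = λ _ → p
  ; cauchy = λ ε 0<ε → 0 , λ _ _ _ _ → subst (λ t → ∣ t ∣ ≤ ε) (sym (ℚₚ.+-inverseʳ p)) (ℚₚ.<⇒≤ 0<ε)
  }

0ᴿ 1ᴿ : ℝ
0ᴿ = constᴿ 0ℚ
1ᴿ = constᴿ 1ℚ

-- Each operation is controlled by a bound on the rational operation, used
-- both for the Cauchy condition and for congruence.

+-close : ∀ a a′ b b′ {ε} → ∣ a - a′ ∣ ≤ ½ * ε → ∣ b - b′ ∣ ≤ ½ * ε →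
          ∣ (a + b) - (a′ + b′) ∣ ≤ ε
+-close a a′ b b′ {ε} h k = ∣∣≤ (a + b) (a′ + b′)
  (half a a′ b b′ (≤+ a a′ h) (≤+ b b′ k)) (half a′ a b′ b (≥- a a′ h) (≥- b b′ k))
  where
  half : ∀ a a′ b b′ → a ≤ a′ + ½ * ε → b ≤ b′ + ½ * ε → a + b ≤ a′ + b′ + ε
  half a a′ b b′ h k = cert _ (0≤+ (0≤-diff h) (0≤-diff k))
    (solve 5 (λ a a′ b b′ ε → a′ :+ b′ :+ ε :- (a :+ b)
      := (a′ :+ con ½ :* ε :- a) :+ (b′ :+ con ½ :* ε :- b)) refl a a′ b b′ ε)

neg-close : ∀ a a′ {ε} → ∣ a - a′ ∣ ≤ ε → ∣ (- a) - (- a′) ∣ ≤ ε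
neg-close a a′ {ε} h = subst (λ t → t ≤ ε)
  (trans (sym (ℚₚ.∣-p∣≡∣p∣ (a - a′))) (cong ∣_∣ (solve 2 (λ a b → :- (a :- b) := (:- a) :- (:- b)) refl a a′))) h

-- δ depends on the bound B and on ε only.
*-modulus : ∀ B ε → 0ℚ < B → 0ℚ < ε → ∃[ δ ] 0ℚ < δ × B * δ + δ * B ≡ ε
*-modulus B ε 0<B 0<ε with reciprocal B 0<B
... | r , 0<r , eq = ½ * (ε * r) , 0<half (0<* 0<ε 0<r) ,
  trans (solve 3 (λ B ε r → B :* (con ½ :* (ε :* r)) :+ con ½ :* (ε :* r) :* B := ε :* (B :* r)) refl B ε r)
    (trans (cong (ε *_) eq) (ℚₚ.*-identityʳ ε))

*-close : ∀ {B δ ε} a a′ b b′ → 0ℚ ≤ B → 0ℚ ≤ δ → B * δ + δ * B ≡ ε → ∣ a ∣ ≤ B → ∣ b′ ∣ ≤ B →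
          ∣ a - a′ ∣ ≤ δ → ∣ b - b′ ∣ ≤ δ → ∣ a * b - a′ * b′ ∣ ≤ ε
*-close {B} {δ} {ε} a a′ b b′ 0≤B 0≤δ eq ha hb h k = begin
  ∣ a * b - a′ * b′ ∣                  ≡⟨ cong ∣_∣ (solve 4 (λ a a′ b b′ →
      a :* b :- a′ :* b′ := a :* (b :- b′) :+ (a :- a′) :* b′) refl a a′ b b′) ⟩
  ∣ a * (b - b′) + (a - a′) * b′ ∣      ≤⟨ ℚₚ.∣p+q∣≤∣p∣+∣q∣ (a * (b - b′)) ((a - a′) * b′) ⟩
  ∣ a * (b - b′) ∣ + ∣ (a - a′) * b′ ∣  ≡⟨ cong₂ _+_ (ℚₚ.∣p*q∣≡∣p∣*∣q∣ a (b - b′)) (ℚₚ.∣p*q∣≡∣p∣*∣q∣ (a - a′) b′) ⟩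
  ∣ a ∣ * ∣ b - b′ ∣ + ∣ a - a′ ∣ * ∣ b′ ∣ ≤⟨ ℚₚ.+-mono-≤
      (*-mono (ℚₚ.0≤∣p∣ a) 0≤δ ha k) (*-mono (ℚₚ.0≤∣p∣ (a - a′)) 0≤B h hb) ⟩
  B * δ + δ * B                          ≡⟨ eq ⟩
  ε                                      ∎
  where open ℚₚ.≤-Reasoning

bounded : ∀ x → ∃[ B ] 0ℚ < B × Eventually (λ n → ∣ seq x n ∣ ≤ B)
bounded x with cauchy x 1ℚ 0<1
... | N , h = B , ℚₚ.+-mono-≤-< (ℚₚ.0≤∣p∣ (seq x N)) 0<1 , N , λ n N≤n → bd n (h n N N≤n ℕₚ.≤-refl)
  where
  B = ∣ seq x N ∣ + 1ℚ
  bd : ∀ n → ∣ seq x n - seq x N ∣ ≤ 1ℚ → ∣ seq x n ∣ ≤ B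
  bd n k = begin
    ∣ seq x n ∣                        ≡⟨ cong ∣_∣ (solve 2 (λ a b → a := b :+ (a :- b)) refl (seq x n) (seq x N)) ⟩
    ∣ seq x N + (seq x n - seq x N) ∣  ≤⟨ ℚₚ.∣p+q∣≤∣p∣+∣q∣ (seq x N) (seq x n - seq x N) ⟩
    ∣ seq x N ∣ + ∣ seq x n - seq x N ∣ ≤⟨ ℚₚ.+-monoʳ-≤ ∣ seq x N ∣ k ⟩
    B ∎
    where open ℚₚ.≤-Reasoning

≤-+ʳ : ∀ p {q} → 0ℚ ≤ q → p ≤ p + q
≤-+ʳ p {q} h = cert q h (solve 2 (λ p q → p :+ q :- p := q) refl p q)

≤-+ˡ : ∀ p {q} → 0ℚ ≤ q → p ≤ q + p
≤-+ˡ p {q} h = cert q h (solve 2 (λ p q → q :+ p :- p := q) refl p q)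

bounded₂ : ∀ x y → ∃[ B ] 0ℚ < B × Eventually (λ n → ∣ seq x n ∣ ≤ B × ∣ seq y n ∣ ≤ B)
bounded₂ x y =
  let (B , 0<B , hB) = bounded x
      (C , 0<C , hC) = bounded y
  in B + C , ℚₚ.+-mono-< 0<B 0<C , both (λ _ p q →
       ℚₚ.≤-trans p (≤-+ʳ B (ℚₚ.<⇒≤ 0<C)) , ℚₚ.≤-trans q (≤-+ˡ C (ℚₚ.<⇒≤ 0<B))) hB hC

⊔₂ : ∀ {M N n} → M ℕ.⊔ N ℕ.≤ n → M ℕ.≤ n × N ℕ.≤ n
⊔₂ {M} {N} h = ℕₚ.≤-trans (ℕₚ.m≤m⊔n M N) h , ℕₚ.≤-trans (ℕₚ.m≤n⊔m M N) h

_+ᴿ_ : ℝ → ℝ → ℝ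
x +ᴿ y = record
  { seq    = λ n → seq x n + seq y n
  ; cauchy = λ ε 0<ε → let
      (M , h) = cauchy x (½ * ε) (0<half 0<ε)
      (N , k) = cauchy y (½ * ε) (0<half 0<ε)
      in M ℕ.⊔ N , λ m n p q → +-close (seq x m) (seq x n) (seq y m) (seq y n)
           (h m n (proj₁ (⊔₂ p)) (proj₁ (⊔₂ q))) (k m n (proj₂ (⊔₂ {M} p)) (proj₂ (⊔₂ {M} q)))
  }

-ᴿ_ : ℝ → ℝ
-ᴿ x = record
  { seq    = λ n → - seq x n
  ; cauchy = λ ε 0<ε → let (N , h) = cauchy x ε 0<ε in
      N , λ m n p q → neg-close (seq x m) (seq x n) (h m n p q)
  }

_*ᴿ_ : ℝ → ℝ → ℝ
x *ᴿ y = record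
  { seq    = λ n → seq x n * seq y n
  ; cauchy = λ ε 0<ε → let
      (B , 0<B , L , b) = bounded₂ x y
      (δ , 0<δ , eq)    = *-modulus B ε 0<B 0<ε
      (M , h) = cauchy x δ 0<δ
      (N , k) = cauchy y δ 0<δ
      in L ℕ.⊔ (M ℕ.⊔ N) , λ m n p q → let
        (p₁ , p₂) = ⊔₂ {L} p
        (q₁ , q₂) = ⊔₂ {L} q
        in *-close (seq x m) (seq x n) (seq y m) (seq y n) (ℚₚ.<⇒≤ 0<B) (ℚₚ.<⇒≤ 0<δ) eq
             (proj₁ (b m p₁)) (proj₂ (b n q₁))
             (h m n (proj₁ (⊔₂ p₂)) (proj₁ (⊔₂ q₂))) (k m n (proj₂ (⊔₂ {M} p₂)) (proj₂ (⊔₂ {M} q₂)))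
  }

pointwise : ∀ {x y} → (∀ n → seq x n ≡ seq y n) → x ≈ᴿ y
pointwise {x} {y} h ε 0<ε = 0 , λ n _ → subst (λ t → ∣ t ∣ ≤ ε)
  (trans (sym (ℚₚ.+-inverseʳ (seq y n))) (cong (_- seq y n) (sym (h n)))) (ℚₚ.<⇒≤ 0<ε)

≈ᴿ-refl : ∀ {x} → x ≈ᴿ x
≈ᴿ-refl {x} = pointwise {x} {x} λ _ → refl

≈ᴿ-sym : ∀ {x y} → x ≈ᴿ y → y ≈ᴿ x
≈ᴿ-sym {x} {y} h ε 0<ε = evmap (λ n → subst (_≤ ε) (∣-∣-sym (seq x n) (seq y n))) (h ε 0<ε)

≈ᴿ-trans : ∀ {x y z} → x ≈ᴿ y → y ≈ᴿ z → x ≈ᴿ z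
≈ᴿ-trans {x} {y} {z} h k ε 0<ε = both (λ n p q → subst (λ t → ∣ t ∣ ≤ ε)
    (solve 3 (λ x y z → (x :+ y) :- (y :+ z) := x :- z) refl (seq x n) (seq y n) (seq z n))
    (+-close (seq x n) (seq y n) (seq y n) (seq z n) p q))
  (h (½ * ε) (0<half 0<ε)) (k (½ * ε) (0<half 0<ε))

+ᴿ-cong : ∀ {x x′ y y′} → x ≈ᴿ x′ → y ≈ᴿ y′ → x +ᴿ y ≈ᴿ x′ +ᴿ y′
+ᴿ-cong {x} {x′} {y} {y′} h k ε 0<ε = both (λ n → +-close (seq x n) (seq x′ n) (seq y n) (seq y′ n))
  (h (½ * ε) (0<half 0<ε)) (k (½ * ε) (0<half 0<ε))

-ᴿ-cong : ∀ {x y} → x ≈ᴿ y → -ᴿ x ≈ᴿ -ᴿ y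
-ᴿ-cong {x} {y} h ε 0<ε = evmap (λ n → neg-close (seq x n) (seq y n)) (h ε 0<ε)

*ᴿ-cong : ∀ {x x′ y y′} → x ≈ᴿ x′ → y ≈ᴿ y′ → x *ᴿ y ≈ᴿ x′ *ᴿ y′
*ᴿ-cong {x} {x′} {y} {y′} h k ε 0<ε =
  let (B , 0<B , b)  = bounded₂ x y′
      (δ , 0<δ , eq) = *-modulus B ε 0<B 0<ε
  in both (λ n (b₁ , b₂) (p , q) → *-close (seq x n) (seq x′ n) (seq y n) (seq y′ n) (ℚₚ.<⇒≤ 0<B) (ℚₚ.<⇒≤ 0<δ) eq b₁ b₂ p q)
       b (both (λ _ → _,_) (h δ 0<δ) (k δ 0<δ))

≈ᴿ-eventually : ∀ {x y} → Eventually (λ n → seq x n ≡ seq y n) → x ≈ᴿ y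
≈ᴿ-eventually {x} {y} h ε 0<ε = evmap (λ n e → subst (λ t → ∣ t ∣ ≤ ε)
  (trans (sym (ℚₚ.+-inverseʳ (seq y n))) (cong (_- seq y n) (sym e))) (ℚₚ.<⇒≤ 0<ε)) h

Pos : ℝ → Set
Pos x = ∃[ ε ] 0ℚ < ε × Eventually (λ n → ε ≤ seq x n)

Pos⇒0< : ∀ {x} → Pos x → 0ᴿ <ᴿ x
Pos⇒0< {x} (ε , 0<ε , h) = ε , 0<ε , evmap (λ n → subst (_≤ seq x n) (sym (ℚₚ.+-identityˡ ε))) h

0<⇒Pos : ∀ {x} → 0ᴿ <ᴿ x → Pos x
0<⇒Pos {x} (ε , 0<ε , h) = ε , 0<ε , evmap (λ n → subst (_≤ seq x n) (ℚₚ.+-identityˡ ε)) h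

Pos-resp : ∀ {x y} → x ≈ᴿ y → Pos x → Pos y
Pos-resp {x} {y} e (ε , 0<ε , h) = ½ * ε , 0<half 0<ε , both (λ n p q →
    cert _ (0≤+ (0≤-diff p) (0≤-diff (≤+ (seq x n) (seq y n) q)))
      (solve 3 (λ x y ε → y :- con ½ :* ε := (x :- ε) :+ (y :+ con ½ :* ε :- x)) refl (seq x n) (seq y n) ε))
  h (e (½ * ε) (0<half 0<ε))

Pos-0 : ¬ Pos 0ᴿ
Pos-0 (ε , 0<ε , N , h) = ≤⇒≯ (h N ℕₚ.≤-refl) 0<ε

Pos-near : ∀ x N ε → 0ℚ < ε → (∀ n → N ℕ.≤ n → ∣ seq x N - seq x n ∣ ≤ ½ * (½ * ε)) →
           ½ * ε ≤ seq x N → Pos x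
Pos-near x N ε 0<ε h k = ½ * (½ * ε) , 0<half (0<half 0<ε) , N , λ n N≤n →
  cert _ (0≤+ (0≤-diff (≤+ (seq x N) (seq x n) (h n N≤n))) (0≤-diff k))
    (solve 3 (λ X x ε → x :- con ½ :* (con ½ :* ε)
      := (x :+ con ½ :* (con ½ :* ε) :- X) :+ (X :- con ½ :* ε)) refl (seq x N) (seq x n) ε)

Pos-cotrans : ∀ x y → Pos (x +ᴿ y) → Pos x ⊎ Pos y
Pos-cotrans x y (ε , 0<ε , L , h) = split (½ * ε ℚₚ.≤? seq x K)
  where
  cx = cauchy x (½ * (½ * ε)) (0<half (0<half 0<ε))
  cy = cauchy y (½ * (½ * ε)) (0<half (0<half 0<ε))
  M = proj₁ cx
  N = proj₁ cy
  K = L ℕ.⊔ (M ℕ.⊔ N)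
  L≤ : ∀ {n} → K ℕ.≤ n → L ℕ.≤ n
  L≤ p = proj₁ (⊔₂ p)
  M≤ : ∀ {n} → K ℕ.≤ n → M ℕ.≤ n
  M≤ p = proj₁ (⊔₂ (proj₂ (⊔₂ {L} p)))
  N≤ : ∀ {n} → K ℕ.≤ n → N ℕ.≤ n
  N≤ p = proj₂ (⊔₂ {M} (proj₂ (⊔₂ {L} p)))
  split : Dec (½ * ε ≤ seq x K) → Pos x ⊎ Pos y
  split (yes p) = inj₁ (Pos-near x K ε 0<ε (λ n q → proj₂ cx K n (M≤ ℕₚ.≤-refl) (M≤ q)) p)
  split (no ¬p) = inj₂ (Pos-near y K ε 0<ε (λ n q → proj₂ cy K n (N≤ ℕₚ.≤-refl) (N≤ q))
    (cert _ (0≤+ (0≤-diff (h K (L≤ ℕₚ.≤-refl))) (0≤-diff (ℚₚ.<⇒≤ (ℚₚ.≰⇒> ¬p))))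
      (solve 3 (λ x y ε → y :- con ½ :* ε := (x :+ y :- ε) :+ (con ½ :* ε :- x)) refl (seq x K) (seq y K) ε)))

¬Pos⇒small : ∀ x → ¬ Pos x → ∀ ε → 0ℚ < ε → Eventually (λ n → seq x n ≤ ε)
¬Pos⇒small x ¬p ε 0<ε with cauchy x (½ * (½ * ε)) (0<half (0<half 0<ε))
... | N , h with ½ * ε ℚₚ.≤? seq x N
...   | yes p = ⊥-elim (¬p (Pos-near x N ε 0<ε (λ n → h N n ℕₚ.≤-refl) p))
...   | no ¬q = N , λ n N≤n → cert _
        (0≤+ (0≤-diff (≤+ (seq x n) (seq x N) (h n N N≤n ℕₚ.≤-refl)))
          (0≤+ (0≤-diff (ℚₚ.<⇒≤ (ℚₚ.≰⇒> ¬q))) (ℚₚ.<⇒≤ (0<half (0<half 0<ε)))))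
        (solve 3 (λ X x ε → ε :- x := (X :+ con ½ :* (con ½ :* ε) :- x)
          :+ ((con ½ :* ε :- X) :+ con ½ :* (con ½ :* ε))) refl (seq x N) (seq x n) ε)

Pos-factor : ∀ x y → (∀ n → 0ℚ ≤ seq x n) → Pos (x *ᴿ y) → Pos x
Pos-factor x y 0≤x (ε , 0<ε , h) =
  let (B , 0<B , b)  = bounded y
      (r , 0<r , eq) = reciprocal B 0<B
  in ε * r , 0<* 0<ε 0<r , both (λ n p q → cert _
       (0≤+ (0≤* (0≤x n) (0≤* (ℚₚ.<⇒≤ 0<r) (0≤-diff (ℚₚ.≤-trans (p≤∣p∣ (seq y n)) q))))
            (0≤* (ℚₚ.<⇒≤ 0<r) (0≤-diff p)))
       (trans (cong (_- ε * r) (sym (trans (cong (seq x n *_) eq) (ℚₚ.*-identityʳ (seq x n)))))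
         (solve 5 (λ x y ε r B → x :* (B :* r) :- ε :* r := x :* (r :* (B :- y)) :+ r :* (x :* y :- ε))
           refl (seq x n) (seq y n) ε r B)))
     h b

invℚ : ℚ → ℚ
invℚ p with 0ℚ ℚₚ.<? p
... | yes 0<p = proj₁ (reciprocal p 0<p)
... | no  _   = 0ℚ

invℚ-spec : ∀ p → 0ℚ < p → p * invℚ p ≡ 1ℚ
invℚ-spec p 0<p with 0ℚ ℚₚ.<? p
... | yes 0<p′ = proj₂ (proj₂ (reciprocal p 0<p′))
... | no ¬0<p  = ⊥-elim (¬0<p 0<p)

0≤invℚ : ∀ p → 0ℚ ≤ invℚ p
0≤invℚ p with 0ℚ ℚₚ.<? p
... | yes 0<p = ℚₚ.<⇒≤ (proj₁ (proj₂ (reciprocal p 0<p)))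
... | no  _   = ℚₚ.≤-refl

-- With  i = 1/x,  j = 1/y,  r = 1/c  and  c ≤ x, y:  i - j = i j (y - x) ≤ r² δ.
inv-close : ∀ c r δ x y → 0ℚ < c → 0ℚ < r → 0ℚ < δ → c * r ≡ 1ℚ → c ≤ x → c ≤ y →
            y ≤ x + δ → invℚ x ≤ invℚ y + r * r * δ
inv-close c r δ x y 0<c 0<r 0<δ cr c≤x c≤y h = cert _
    (0≤+ (0≤* (0≤* (0≤invℚ x) (0≤invℚ y)) (0≤-diff h))
      (0≤* (ℚₚ.<⇒≤ 0<δ) (0≤+ (0≤* 0≤r (0≤-diff (bnd y c≤y))) (0≤* (0≤invℚ y) (0≤-diff (bnd x c≤x))))))
    (trans (cong₂ _-_ (cong (_+ r * r * δ) (expand x (invℚ y) c≤x)) (expand y (invℚ x) c≤y))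
      (solve 6 (λ x y i j r δ → j :* (x :* i) :+ r :* r :* δ :- i :* (y :* j)
        := i :* j :* (x :+ δ :- y) :+ δ :* (r :* (r :- j) :+ j :* (r :- i)))
        refl x y (invℚ x) (invℚ y) r δ))
  where
  0≤r : 0ℚ ≤ r
  0≤r = ℚₚ.<⇒≤ 0<r
  expand : ∀ x i → c ≤ x → i ≡ i * (x * invℚ x)
  expand x i c≤x = sym (trans (cong (i *_) (invℚ-spec x (ℚₚ.<-≤-trans 0<c c≤x))) (ℚₚ.*-identityʳ i))
  bnd : ∀ x → c ≤ x → invℚ x ≤ r
  bnd x c≤x = cert _ (0≤* (0≤* 0≤r (0≤-diff c≤x)) (0≤invℚ x))
    (trans (cong₂ _-_ (expand x r c≤x) (sym (trans (cong (invℚ x *_) cr) (ℚₚ.*-identityʳ (invℚ x)))))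
      (solve 4 (λ x i c r → r :* (x :* i) :- i :* (c :* r) := r :* (x :- c) :* i) refl x (invℚ x) c r))

invᴿ : ∀ x → Pos x → ℝ
invᴿ x (c , 0<c , L , b) = record
  { seq    = λ n → invℚ (seq x n)
  ; cauchy = λ ε 0<ε → let
      (r , 0<r , cr) = reciprocal c 0<c
      δ   = c * c * ε
      0<δ = 0<* (0<* 0<c 0<c) 0<ε
      (N , h) = cauchy x δ 0<δ
      rrδ : r * r * δ ≡ ε
      rrδ = trans (solve 3 (λ c r ε → r :* r :* (c :* c :* ε) := (c :* r) :* (c :* r) :* ε) refl c r ε)
              (trans (cong (λ t → t * t * ε) cr) (trans (cong (_* ε) (ℚₚ.*-identityˡ 1ℚ)) (ℚₚ.*-identityˡ ε)))
      in one-sided {λ n → invℚ (seq x n)} (L ℕ.⊔ N , λ _ K≤ m n p q → let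
        p′ = ⊔₂ {L} (ℕₚ.≤-trans K≤ p)
        q′ = ⊔₂ {L} (ℕₚ.≤-trans K≤ q)
        in subst (λ t → invℚ (seq x m) ≤ invℚ (seq x n) + t) rrδ
          (inv-close c r δ (seq x m) (seq x n) 0<c 0<r 0<δ cr (b m (proj₁ p′)) (b n (proj₁ q′))
            (≤+ (seq x n) (seq x m) (h n m (proj₂ q′) (proj₂ p′)))))
  }

invᴿ-spec : ∀ x p → Eventually (λ n → seq x n * seq (invᴿ x p) n ≡ 1ℚ)
invᴿ-spec x (c , 0<c , h) = evmap (λ n c≤x → invℚ-spec (seq x n) (ℚₚ.<-≤-trans 0<c c≤x)) h

-- Square root by bisecting [0 , x + 1]: for x ≥ 0,
-- (lower x n)² ≤ x < (lower x n + width x n)².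
width : ℚ → ℕ → ℚ
width x zero    = x + 1ℚ
width x (suc n) = ½ * width x n

lower : ℚ → ℕ → ℚ
lower x zero    = 0ℚ
lower x (suc n) =
  let mid = lower x n + width x (suc n)
  in if ⌊ mid * mid ℚₚ.≤? x ⌋ then mid else lower x n

width≡ : ∀ x n → width x n ≡ ½^ n * (x + 1ℚ)
width≡ x zero    = sym (ℚₚ.*-identityˡ (x + 1ℚ))
width≡ x (suc n) = trans (cong (½ *_) (width≡ x n)) (sym (ℚₚ.*-assoc ½ (½^ n) (x + 1ℚ)))

0≤width : ∀ x n → 0ℚ ≤ x → 0ℚ ≤ width x n
0≤width x zero    0≤x = 0≤+ 0≤x (ℚₚ.<⇒≤ 0<1)
0≤width x (suc n) 0≤x = 0≤* 0≤½ (0≤width x n 0≤x)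

0≤lower : ∀ x n → 0ℚ ≤ x → 0ℚ ≤ lower x n
0≤lower x zero    0≤x = ℚₚ.≤-refl
0≤lower x (suc n) 0≤x
  with (lower x n + ½ * width x n) * (lower x n + ½ * width x n) ℚₚ.≤? x
... | yes _ = 0≤+ (0≤lower x n 0≤x) (0≤width x (suc n) 0≤x)
... | no  _ = 0≤lower x n 0≤x

lower² : ∀ x n → 0ℚ ≤ x → lower x n * lower x n ≤ x
lower² x zero    0≤x = 0≤x
lower² x (suc n) 0≤x
  with (lower x n + ½ * width x n) * (lower x n + ½ * width x n) ℚₚ.≤? x
... | yes p = p
... | no  _ = lower² x n 0≤x

upper² : ∀ x n → 0ℚ ≤ x → x < (lower x n + width x n) * (lower x n + width x n)
upper² x zero    0≤x = cert< _ (ℚₚ.+-mono-<-≤ 0<1 (0≤+ 0≤x (0≤* 0≤x 0≤x)))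
  (solve 1 (λ x → (con 0ℚ :+ (x :+ con 1ℚ)) :* (con 0ℚ :+ (x :+ con 1ℚ)) :- x
    := con 1ℚ :+ (x :+ x :* x)) refl x)
upper² x (suc n) 0≤x
  with (lower x n + ½ * width x n) * (lower x n + ½ * width x n) ℚₚ.≤? x
... | yes _ = subst (x <_) (solve 2 (λ l w → (l :+ w) :* (l :+ w)
      := (l :+ con ½ :* w :+ con ½ :* w) :* (l :+ con ½ :* w :+ con ½ :* w)) refl (lower x n) (width x n))
      (upper² x n 0≤x)
... | no ¬p = ℚₚ.≰⇒> ¬p

width-small : ∀ x → (∀ n → 0ℚ ≤ seq x n) → ∀ ε → 0ℚ < ε → Eventually (λ n → width (seq x n) n ≤ ε)
width-small x 0≤x ε 0<ε =
  let (B , 0<B , b)  = bounded x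
      0<B+1          = ℚₚ.+-mono-< 0<B 0<1
      (r , 0<r , eq) = reciprocal (B + 1ℚ) 0<B+1
  in both (λ n p q → subst₂ _≤_ (sym (width≡ (seq x n) n))
         (trans (solve 3 (λ ε r B → ε :* r :* B := ε :* (B :* r)) refl ε r (B + 1ℚ))
           (trans (cong (ε *_) eq) (ℚₚ.*-identityʳ ε)))
         (*-mono (0≤½^ n) (ℚₚ.<⇒≤ 0<B+1) q (ℚₚ.+-monoˡ-≤ 1ℚ (ℚₚ.≤-trans (p≤∣p∣ (seq x n)) p))))
       b (½^→0 (ε * r) (0<* 0<ε 0<r))

-- If  r² ≤ x ≤ y + (ε/2)²,  y < (s + w)²  and  w ≤ ε/2,  then  r² ≤ (s + ε)².
sqrt-close : ∀ {r s w x y ε} → 0ℚ ≤ s → 0ℚ ≤ w → 0ℚ ≤ ε → r * r ≤ x → y < (s + w) * (s + w) →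
             w ≤ ½ * ε → x ≤ y + (½ * ε) * (½ * ε) → r ≤ s + ε
sqrt-close {r} {s} {w} {x} {y} {ε} 0≤s 0≤w 0≤ε p q w≤ x≤ = sq-cancel-≤ (0≤+ 0≤s 0≤ε) (cert _
  (0≤+ (0≤-diff p) (0≤+ (0≤-diff x≤) (0≤+ (0≤-diff (ℚₚ.<⇒≤ q))
    (0≤+ (0≤* (0≤-diff w≤) (0≤+ (0≤+ (0≤+ 0≤s 0≤s) 0≤w) 0≤e)) (0≤+ (0≤* 0≤s 0≤ε) (0≤* 0≤e 0≤ε))))))
  (solve 6 (λ r s w x y ε → (s :+ ε) :* (s :+ ε) :- r :* r
    := (x :- r :* r) :+ ((y :+ con ½ :* ε :* (con ½ :* ε) :- x) :+ (((s :+ w) :* (s :+ w) :- y)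
       :+ ((con ½ :* ε :- w) :* (s :+ s :+ w :+ con ½ :* ε) :+ (s :* ε :+ con ½ :* ε :* ε)))))
    refl r s w x y ε))
  where
  0≤e : 0ℚ ≤ ½ * ε
  0≤e = 0≤* 0≤½ 0≤ε

sqrtᴿ : ∀ x → (∀ n → 0ℚ ≤ seq x n) → ℝ
sqrtᴿ x 0≤x = record
  { seq    = λ n → lower (seq x n) n
  ; cauchy = λ ε 0<ε → let
      0<e = 0<half 0<ε
      (M , w) = width-small x 0≤x (½ * ε) 0<e
      (N , h) = cauchy x ((½ * ε) * (½ * ε)) (0<* 0<e 0<e)
      in one-sided {λ n → lower (seq x n) n} (M ℕ.⊔ N , λ _ K≤ m n p q → let
        p′ = ⊔₂ {M} (ℕₚ.≤-trans K≤ p)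
        q′ = ⊔₂ {M} (ℕₚ.≤-trans K≤ q)
        in sqrt-close (0≤lower _ n (0≤x n)) (0≤width _ n (0≤x n)) (ℚₚ.<⇒≤ 0<ε)
             (lower² _ m (0≤x m)) (upper² _ n (0≤x n)) (w n (proj₁ q′))
             (≤+ (seq x m) (seq x n) (h m n (proj₂ p′) (proj₂ q′))))
  }

sqrt-0< : ∀ x 0≤x → 0ᴿ <ᴿ sqrtᴿ x 0≤x → Pos x
sqrt-0< x 0≤x h with 0<⇒Pos {sqrtᴿ x 0≤x} h
... | ε , 0<ε , k = ε * ε , 0<* 0<ε 0<ε , evmap (λ n p → ℚₚ.≤-trans
  (*-mono (ℚₚ.<⇒≤ 0<ε) (0≤lower (seq x n) n (0≤x n)) p p) (lower² (seq x n) n (0≤x n))) k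

sqrt-<1 : ∀ x 0≤x → sqrtᴿ x 0≤x <ᴿ 1ᴿ → x <ᴿ 1ᴿ
sqrt-<1 x 0≤x (ε , 0<ε , h) = ½ * ε , 0<half 0<ε , both
  (λ n p q → bound (seq x n) _ _ (0≤lower _ n (0≤x n)) (0≤width _ n (0≤x n)) (upper² _ n (0≤x n)) p q)
  h (width-small x 0≤x (½ * ε) (0<half 0<ε))
  where
  bound : ∀ x r w → 0ℚ ≤ r → 0ℚ ≤ w → x < (r + w) * (r + w) → r + ε ≤ 1ℚ → w ≤ ½ * ε →
          x + ½ * ε ≤ 1ℚ
  bound x r w 0≤r 0≤w u p q = cert _
    (0≤+ (0≤-diff (ℚₚ.<⇒≤ u)) (0≤+ 0≤d (0≤* (0≤+ 0≤r 0≤w) (0≤+ 0≤d (ℚₚ.<⇒≤ (0<half 0<ε))))))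
    (solve 4 (λ x r w ε → con 1ℚ :- (x :+ con ½ :* ε) := ((r :+ w) :* (r :+ w) :- x)
      :+ ((con 1ℚ :- (r :+ ε) :+ (con ½ :* ε :- w)) :+ (r :+ w) :*
          ((con 1ℚ :- (r :+ ε) :+ (con ½ :* ε :- w)) :+ con ½ :* ε))) refl x r w ε)
    where
    0≤d : 0ℚ ≤ 1ℚ - (r + ε) + (½ * ε - w)
    0≤d = 0≤+ (0≤-diff p) (0≤-diff q)

-- Without η, so that arithmetic on a variable does not unfold.
record ℂ : Set where
  no-eta-equality
  pattern
  constructor _+i_
  field
    re im : ℝ

open ℂ public

infix 4 _≈ᶜ_ _#ᶜ_
infixl 6 _+ᶜ_
infixl 7 _*ᶜ_
infix 8 -ᶜ_

_≈ᶜ_ : ℂ → ℂ → Set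
z ≈ᶜ w = re z ≈ᴿ re w × im z ≈ᴿ im w

0ᶜ 1ᶜ : ℂ
0ᶜ = 0ᴿ +i 0ᴿ
1ᶜ = 1ᴿ +i 0ᴿ

_+ᶜ_ : ℂ → ℂ → ℂ
(a +i b) +ᶜ (c +i d) = (a +ᴿ c) +i (b +ᴿ d)

-ᶜ_ : ℂ → ℂ
-ᶜ (a +i b) = (-ᴿ a) +i (-ᴿ b)

_*ᶜ_ : ℂ → ℂ → ℂ
(a +i b) *ᶜ (c +i d) = (a *ᴿ c +ᴿ -ᴿ (b *ᴿ d)) +i (a *ᴿ d +ᴿ b *ᴿ c)

normSq : ℂ → ℝ
normSq z = re z *ᴿ re z +ᴿ im z *ᴿ im z

0≤normSq : ∀ z n → 0ℚ ≤ seq (normSq z) n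
0≤normSq z n = 0≤+ (0≤sq (seq (re z) n)) (0≤sq (seq (im z) n))

‖_‖ : ℂ → ℝ
‖ z ‖ = sqrtᴿ (normSq z) (0≤normSq z)

-- |z - w|² > 0; the constructive form of z ≠ w.
_#ᶜ_ : ℂ → ℂ → Set
z #ᶜ w = 0ᴿ <ᴿ normSq (z +ᶜ -ᶜ w)

≈ᶜ-trans : ∀ {x y z} → x ≈ᶜ y → y ≈ᶜ z → x ≈ᶜ z
≈ᶜ-trans {x} {y} {z} (p , q) (r , s) =
  ≈ᴿ-trans {re x} {re y} {re z} p r , ≈ᴿ-trans {im x} {im y} {im z} q s

≈ᶜ-sym : ∀ {x y} → x ≈ᶜ y → y ≈ᶜ x
≈ᶜ-sym {x} {y} (p , q) = ≈ᴿ-sym {re x} {re y} p , ≈ᴿ-sym {im x} {im y} q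

≈ᶜ-refl : ∀ {x} → x ≈ᶜ x
≈ᶜ-refl {x} = ≈ᴿ-refl {re x} , ≈ᴿ-refl {im x}

+ᶜ-cong : ∀ {x x′ y y′} → x ≈ᶜ x′ → y ≈ᶜ y′ → x +ᶜ y ≈ᶜ x′ +ᶜ y′
+ᶜ-cong {a +i b} {a′ +i b′} {c +i d} {c′ +i d′} (p , q) (r , s) =
  +ᴿ-cong {a} {a′} {c} {c′} p r , +ᴿ-cong {b} {b′} {d} {d′} q s

-ᶜ-cong : ∀ {x y} → x ≈ᶜ y → -ᶜ x ≈ᶜ -ᶜ y
-ᶜ-cong {a +i b} {c +i d} (p , q) = -ᴿ-cong {a} {c} p , -ᴿ-cong {b} {d} q

*ᶜ-cong : ∀ {x x′ y y′} → x ≈ᶜ x′ → y ≈ᶜ y′ → x *ᶜ y ≈ᶜ x′ *ᶜ y′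
*ᶜ-cong {a +i b} {a′ +i b′} {c +i d} {c′ +i d′} (p , q) (r , s) =
  +ᴿ-cong {a *ᴿ c} {a′ *ᴿ c′} { -ᴿ (b *ᴿ d)} { -ᴿ (b′ *ᴿ d′)}
    (*ᴿ-cong {a} {a′} {c} {c′} p r)
    (-ᴿ-cong {b *ᴿ d} {b′ *ᴿ d′} (*ᴿ-cong {b} {b′} {d} {d′} q s)) ,
  +ᴿ-cong {a *ᴿ d} {a′ *ᴿ d′} {b *ᴿ c} {b′ *ᴿ c′}
    (*ᴿ-cong {a} {a′} {d} {d′} p s) (*ᴿ-cong {b} {b′} {c} {c′} q r)

normSq-cong : ∀ {z w} → z ≈ᶜ w → normSq z ≈ᴿ normSq w
normSq-cong {a +i b} {c +i d} (p , q) =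
  +ᴿ-cong {a *ᴿ a} {c *ᴿ c} {b *ᴿ b} {d *ᴿ d} (*ᴿ-cong {a} {c} {a} {c} p p) (*ᴿ-cong {b} {d} {b} {d} q q)

private
  pw : ∀ z w → (∀ n → seq (re z) n ≡ seq (re w) n) → (∀ n → seq (im z) n ≡ seq (im w) n) → z ≈ᶜ w
  pw z w p q = pointwise {re z} {re w} p , pointwise {im z} {im w} q

  +ᶜ-assoc : ∀ x y z → (x +ᶜ y) +ᶜ z ≈ᶜ x +ᶜ (y +ᶜ z)
  +ᶜ-assoc x@(a +i b) y@(c +i d) z@(e +i f) = pw ((x +ᶜ y) +ᶜ z) (x +ᶜ (y +ᶜ z))
    (λ n → ℚₚ.+-assoc (seq a n) (seq c n) (seq e n)) (λ n → ℚₚ.+-assoc (seq b n) (seq d n) (seq f n))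

  +ᶜ-comm : ∀ z w → z +ᶜ w ≈ᶜ w +ᶜ z
  +ᶜ-comm z@(a +i b) w@(c +i d) = pw (z +ᶜ w) (w +ᶜ z)
    (λ n → ℚₚ.+-comm (seq a n) (seq c n)) (λ n → ℚₚ.+-comm (seq b n) (seq d n))

  +ᶜ-identityˡ : ∀ z → 0ᶜ +ᶜ z ≈ᶜ z
  +ᶜ-identityˡ z@(a +i b) = pw (0ᶜ +ᶜ z) z
    (λ n → ℚₚ.+-identityˡ (seq a n)) (λ n → ℚₚ.+-identityˡ (seq b n))

  +ᶜ-inverseʳ : ∀ z → z +ᶜ -ᶜ z ≈ᶜ 0ᶜ
  +ᶜ-inverseʳ z@(a +i b) = pw (z +ᶜ -ᶜ z) 0ᶜ
    (λ n → ℚₚ.+-inverseʳ (seq a n)) (λ n → ℚₚ.+-inverseʳ (seq b n))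

  *ᶜ-comm : ∀ z w → z *ᶜ w ≈ᶜ w *ᶜ z
  *ᶜ-comm z@(a +i b) w@(c +i d) = pw (z *ᶜ w) (w *ᶜ z)
    (λ n → solve 4 (λ a b c d → a :* c :+ (:- (b :* d)) := c :* a :+ (:- (d :* b)))
             refl (seq a n) (seq b n) (seq c n) (seq d n))
    (λ n → solve 4 (λ a b c d → a :* d :+ b :* c := c :* b :+ d :* a)
             refl (seq a n) (seq b n) (seq c n) (seq d n))

  *ᶜ-assoc : ∀ x y z → (x *ᶜ y) *ᶜ z ≈ᶜ x *ᶜ (y *ᶜ z)
  *ᶜ-assoc x@(a +i b) y@(c +i d) z@(e +i f) = pw ((x *ᶜ y) *ᶜ z) (x *ᶜ (y *ᶜ z))
    (λ n → solve 6 (λ a b c d e f →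
        (a :* c :+ (:- (b :* d))) :* e :+ (:- ((a :* d :+ b :* c) :* f))
          := a :* (c :* e :+ (:- (d :* f))) :+ (:- (b :* (c :* f :+ d :* e))))
      refl (seq a n) (seq b n) (seq c n) (seq d n) (seq e n) (seq f n))
    (λ n → solve 6 (λ a b c d e f →
        (a :* c :+ (:- (b :* d))) :* f :+ (a :* d :+ b :* c) :* e
          := a :* (c :* f :+ d :* e) :+ b :* (c :* e :+ (:- (d :* f))))
      refl (seq a n) (seq b n) (seq c n) (seq d n) (seq e n) (seq f n))

  *ᶜ-identityˡ : ∀ z → 1ᶜ *ᶜ z ≈ᶜ z
  *ᶜ-identityˡ z@(a +i b) = pw (1ᶜ *ᶜ z) z
    (λ n → solve 2 (λ a b → con 1ℚ :* a :+ (:- (con 0ℚ :* b)) := a) refl (seq a n) (seq b n))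
    (λ n → solve 2 (λ a b → con 1ℚ :* b :+ con 0ℚ :* a := b) refl (seq a n) (seq b n))

  distribˡ : ∀ x y z → x *ᶜ (y +ᶜ z) ≈ᶜ x *ᶜ y +ᶜ x *ᶜ z
  distribˡ x@(a +i b) y@(c +i d) z@(e +i f) = pw (x *ᶜ (y +ᶜ z)) (x *ᶜ y +ᶜ x *ᶜ z)
    (λ n → solve 6 (λ a b c d e f → a :* (c :+ e) :+ (:- (b :* (d :+ f)))
          := (a :* c :+ (:- (b :* d))) :+ (a :* e :+ (:- (b :* f))))
      refl (seq a n) (seq b n) (seq c n) (seq d n) (seq e n) (seq f n))
    (λ n → solve 6 (λ a b c d e f → a :* (d :+ f) :+ b :* (c :+ e)
          := (a :* d :+ b :* c) :+ (a :* f :+ b :* e))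
      refl (seq a n) (seq b n) (seq c n) (seq d n) (seq e n) (seq f n))

ℂ-isCommutativeRing : IsCommutativeRing _≈ᶜ_ _+ᶜ_ _*ᶜ_ -ᶜ_ 0ᶜ 1ᶜ
ℂ-isCommutativeRing = record
  { isRing = record
    { +-isAbelianGroup = record
      { isGroup = record
        { isMonoid = record
          { isSemigroup = record
            { isMagma = record
              { isEquivalence = record
                { refl  = λ {x} → ≈ᶜ-refl {x}
                ; sym   = λ {x} {y} → ≈ᶜ-sym {x} {y}
                ; trans = λ {x} {y} {z} → ≈ᶜ-trans {x} {y} {z}
                }
              ; ∙-cong = λ {x} {x′} {y} {y′} → +ᶜ-cong {x} {x′} {y} {y′}
              }
            ; assoc = +ᶜ-assoc
            }
          ; identity = +ᶜ-identityˡ , λ z → ≈ᶜ-trans {z +ᶜ 0ᶜ} {0ᶜ +ᶜ z} {z} (+ᶜ-comm z 0ᶜ) (+ᶜ-identityˡ z)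
          }
        ; inverse = (λ z → ≈ᶜ-trans { -ᶜ z +ᶜ z} {z +ᶜ -ᶜ z} {0ᶜ} (+ᶜ-comm (-ᶜ z) z) (+ᶜ-inverseʳ z)) ,
                    +ᶜ-inverseʳ
        ; ⁻¹-cong = λ {x} {y} → -ᶜ-cong {x} {y}
        }
      ; comm = +ᶜ-comm
      }
    ; *-cong = λ {x} {x′} {y} {y′} → *ᶜ-cong {x} {x′} {y} {y′}
    ; *-assoc = *ᶜ-assoc
    ; *-identity = *ᶜ-identityˡ , λ z → ≈ᶜ-trans {z *ᶜ 1ᶜ} {1ᶜ *ᶜ z} {z} (*ᶜ-comm z 1ᶜ) (*ᶜ-identityˡ z)
    ; distrib = distribˡ , λ x y z → ≈ᶜ-trans {(y +ᶜ z) *ᶜ x} {x *ᶜ (y +ᶜ z)} {y *ᶜ x +ᶜ z *ᶜ x}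
        (*ᶜ-comm (y +ᶜ z) x)
        (≈ᶜ-trans {x *ᶜ (y +ᶜ z)} {x *ᶜ y +ᶜ x *ᶜ z} {y *ᶜ x +ᶜ z *ᶜ x} (distribˡ x y z)
          (+ᶜ-cong {x *ᶜ y} {y *ᶜ x} {x *ᶜ z} {z *ᶜ x} (*ᶜ-comm x y) (*ᶜ-comm x z)))
    }
  ; *-comm = *ᶜ-comm
  }

invᶜ : ∀ z → Pos (normSq z) → ℂ
invᶜ z p = (re z *ᴿ invᴿ (normSq z) p) +i (-ᴿ (im z *ᴿ invᴿ (normSq z) p))

invᶜ-inverseʳ : ∀ z p → z *ᶜ invᶜ z p ≈ᶜ 1ᶜ
invᶜ-inverseʳ z@(a +i b) p =
  ≈ᴿ-eventually {re (z *ᶜ invᶜ z p)} {1ᴿ} (evmap (λ n e → trans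
    (solve 3 (λ a b i → a :* (a :* i) :+ (:- (b :* (:- (b :* i)))) := (a :* a :+ b :* b) :* i)
      refl (seq a n) (seq b n) (seq (invᴿ (normSq z) p) n)) e) (invᴿ-spec (normSq z) p)) ,
  pointwise {im (z *ᶜ invᶜ z p)} {0ᴿ} (λ n →
    solve 3 (λ a b i → a :* (:- (b :* i)) :+ b :* (a :* i) := con 0ℚ)
      refl (seq a n) (seq b n) (seq (invᴿ (normSq z) p) n))

normSq-* : ∀ z w n → seq (normSq (z *ᶜ w)) n ≡ seq (normSq z) n * seq (normSq w) n
normSq-* (a +i b) (c +i d) n = solve 4 (λ a b c d →
    (a :* c :+ (:- (b :* d))) :* (a :* c :+ (:- (b :* d))) :+ (a :* d :+ b :* c) :* (a :* d :+ b :* c)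
      := (a :* a :+ b :* b) :* (c :* c :+ d :* d))
  refl (seq a n) (seq b n) (seq c n) (seq d n)

#ᶜ⇒Pos : ∀ {z w} → z #ᶜ w → Pos (normSq (z +ᶜ -ᶜ w))
#ᶜ⇒Pos {z} {w} = 0<⇒Pos {normSq (z +ᶜ -ᶜ w)}

Pos⇒#ᶜ : ∀ {z w} → Pos (normSq (z +ᶜ -ᶜ w)) → z #ᶜ w
Pos⇒#ᶜ {z} {w} = Pos⇒0< {normSq (z +ᶜ -ᶜ w)}

#ᶜ-irrefl : ∀ {z w} → z ≈ᶜ w → ¬ (z #ᶜ w)
#ᶜ-irrefl {z} {w@(a +i b)} z≈w z#w = Pos-0 (Pos-resp {normSq (z +ᶜ -ᶜ w)} {0ᴿ}
  (≈ᴿ-trans {normSq (z +ᶜ -ᶜ w)} {normSq (w +ᶜ -ᶜ w)} {0ᴿ}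
    (normSq-cong {z +ᶜ -ᶜ w} {w +ᶜ -ᶜ w}
      (+ᶜ-cong {z} {w} { -ᶜ w} { -ᶜ w} z≈w (≈ᶜ-refl { -ᶜ w})))
    (pointwise {normSq (w +ᶜ -ᶜ w)} {0ᴿ} λ n →
      solve 2 (λ a b → (a :+ (:- a)) :* (a :+ (:- a)) :+ (b :+ (:- b)) :* (b :+ (:- b)) := con 0ℚ)
        refl (seq a n) (seq b n)))
  (#ᶜ⇒Pos {z} {w} z#w))

#ᶜ-sym : ∀ {z w} → z #ᶜ w → w #ᶜ z
#ᶜ-sym {z@(a +i b)} {w@(c +i d)} h = Pos⇒#ᶜ {w} {z} (Pos-resp {normSq (z +ᶜ -ᶜ w)} {normSq (w +ᶜ -ᶜ z)}
  (pointwise {normSq (z +ᶜ -ᶜ w)} {normSq (w +ᶜ -ᶜ z)} λ n →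
    solve 4 (λ a b c d →
      (a :+ (:- c)) :* (a :+ (:- c)) :+ (b :+ (:- d)) :* (b :+ (:- d))
        := (c :+ (:- a)) :* (c :+ (:- a)) :+ (d :+ (:- b)) :* (d :+ (:- b)))
      refl (seq a n) (seq b n) (seq c n) (seq d n))
  (#ᶜ⇒Pos {z} {w} h))

-- From  |x - y|² ≤ 2 |x - z|² + 2 |z - y|².
half-triangle : ∀ a c e → ½ * ((a - c) * (a - c)) ≤ (a - e) * (a - e) + (e - c) * (e - c)
half-triangle a c e = cert _ (0≤* 0≤½ (0≤sq (a - e - (e - c))))
  (solve 3 (λ a c e → (a :- e) :* (a :- e) :+ (e :- c) :* (e :- c) :- con ½ :* ((a :- c) :* (a :- c))
    := con ½ :* ((a :- e :- (e :- c)) :* (a :- e :- (e :- c)))) refl a c e)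

½-combine : ∀ A B p p′ q q′ {ε} → ε ≤ A + B → ½ * A ≤ p + p′ → ½ * B ≤ q + q′ →
          ½ * ε ≤ p + q + (p′ + q′)
½-combine A B p p′ q q′ {ε} h k l =
  cert _ (0≤+ (0≤* 0≤½ (0≤-diff h)) (0≤+ (0≤-diff k) (0≤-diff l)))
    (solve 7 (λ A B p p′ q q′ ε → p :+ q :+ (p′ :+ q′) :- con ½ :* ε
      := con ½ :* (A :+ B :- ε) :+ ((p :+ p′ :- con ½ :* A) :+ (q :+ q′ :- con ½ :* B)))
      refl A B p p′ q q′ ε)

normSq-triangle : ∀ x y z n {ε} → ε ≤ seq (normSq (x +ᶜ -ᶜ y)) n →
  ½ * ε ≤ seq (normSq (x +ᶜ -ᶜ z) +ᴿ normSq (z +ᶜ -ᶜ y)) n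
normSq-triangle (xr +i xi) (yr +i yi) (zr +i zi) n h = ½-combine
  ((a - c) * (a - c)) ((b - d) * (b - d))
  ((a - e) * (a - e)) ((e - c) * (e - c)) ((b - f) * (b - f)) ((f - d) * (f - d))
  h (half-triangle a c e) (half-triangle b d f)
  where
  a = seq xr n
  b = seq xi n
  c = seq yr n
  d = seq yi n
  e = seq zr n
  f = seq zi n

#ᶜ-cotrans : ∀ {x y} → x #ᶜ y → ∀ z → (x #ᶜ z) ⊎ (z #ᶜ y)
#ᶜ-cotrans {x} {y} x#y z =
  let (ε , 0<ε , h) = #ᶜ⇒Pos {x} {y} x#y
  in Sum.map (Pos⇒#ᶜ {x} {z}) (Pos⇒#ᶜ {z} {y})
       (Pos-cotrans (normSq (x +ᶜ -ᶜ z)) (normSq (z +ᶜ -ᶜ y))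
         (½ * ε , 0<half 0<ε , evmap (λ n → normSq-triangle x y z n) h))

#ᶜ-tight : ∀ z w → (¬ (z #ᶜ w) → z ≈ᶜ w) × (z ≈ᶜ w → ¬ (z #ᶜ w))
#ᶜ-tight z@(_ +i _) w@(_ +i _) = (λ h → (λ ε 0<ε → evmap (λ n p → root (seq (re z) n) (seq (re w) n) 0<ε
                        (ℚₚ.≤-trans (≤-+ʳ _ (0≤sq (seq (im z) n - seq (im w) n))) p)) (small h ε 0<ε))
                    , (λ ε 0<ε → evmap (λ n p → root (seq (im z) n) (seq (im w) n) 0<ε
                        (ℚₚ.≤-trans (≤-+ˡ _ (0≤sq (seq (re z) n - seq (re w) n))) p)) (small h ε 0<ε)))
               , #ᶜ-irrefl {z} {w}
  where
  small : ¬ (z #ᶜ w) → ∀ ε → 0ℚ < ε → Eventually (λ n → seq (normSq (z +ᶜ -ᶜ w)) n ≤ ε * ε)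
  small h ε 0<ε = ¬Pos⇒small (normSq (z +ᶜ -ᶜ w)) (λ p → h (Pos⇒#ᶜ {z} {w} p)) (ε * ε) (0<* 0<ε 0<ε)
  root : ∀ a c {ε} → 0ℚ < ε → (a - c) * (a - c) ≤ ε * ε → ∣ a - c ∣ ≤ ε
  root a c {ε} 0<ε p = ∣∣≤ a c
    (shift a c (sq-cancel-≤ (ℚₚ.<⇒≤ 0<ε) p))
    (shift c a (sq-cancel-≤ (ℚₚ.<⇒≤ 0<ε) (subst (_≤ ε * ε)
      (solve 2 (λ a c → (a :- c) :* (a :- c) := (c :- a) :* (c :- a)) refl a c) p)))
    where
    shift : ∀ a c → a - c ≤ ε → a ≤ c + ε
    shift a c h = cert _ (0≤-diff h) (solve 3 (λ a c ε → c :+ ε :- a := ε :- (a :- c)) refl a c ε)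

opaque
  ℂ-isHeytingField : IsHeytingField _≈ᶜ_ _#ᶜ_ _+ᶜ_ _*ᶜ_ -ᶜ_ 0ᶜ 1ᶜ
  ℂ-isHeytingField = record
    { isHeytingCommutativeRing = record
      { isCommutativeRing   = ℂ-isCommutativeRing
      ; isApartnessRelation = record
        { irrefl  = λ {x} {y} → #ᶜ-irrefl {x} {y}
        ; sym     = λ {x} {y} → #ᶜ-sym {x} {y}
        ; cotrans = λ {x} {y} → #ᶜ-cotrans {x} {y}
        }
      ; #⇒invertible = λ {x} {y} → #⇒inv x y
      ; invertible⇒# = λ {x} {y} → inv⇒# x y
      }
    ; tight = #ᶜ-tight
    }
    where
    open import Algebra.Definitions _≈ᶜ_ using (Invertible)
    #⇒inv : ∀ x y → x #ᶜ y → Invertible 1ᶜ _*ᶜ_ (x +ᶜ -ᶜ y)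
    #⇒inv x y h =
      let d = x +ᶜ -ᶜ y
          p = #ᶜ⇒Pos {x} {y} h
      in invᶜ d p , ≈ᶜ-trans {invᶜ d p *ᶜ d} {d *ᶜ invᶜ d p} {1ᶜ} (*ᶜ-comm (invᶜ d p) d) (invᶜ-inverseʳ d p)
                  , invᶜ-inverseʳ d p
    inv⇒# : ∀ x y → Invertible 1ᶜ _*ᶜ_ (x +ᶜ -ᶜ y) → x #ᶜ y
    inv⇒# x y (w , _ , dw≈1) =
      let d = x +ᶜ -ᶜ y
      in Pos⇒#ᶜ {x} {y} (Pos-factor (normSq d) (normSq w) (0≤normSq d)
           (Pos-resp {normSq 1ᶜ} {normSq d *ᴿ normSq w}
             (≈ᴿ-trans {normSq 1ᶜ} {normSq (d *ᶜ w)} {normSq d *ᴿ normSq w}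
               (normSq-cong {1ᶜ} {d *ᶜ w} (≈ᶜ-sym {d *ᶜ w} {1ᶜ} dw≈1))
               (pointwise {normSq (d *ᶜ w)} {normSq d *ᴿ normSq w} (normSq-* d w)))
             (1ℚ , 0<1 , 0 , λ _ _ → ℚₚ.≤-refl)))

ℂ-heytingField : HeytingField 0ℓ 0ℓ 0ℓ
ℂ-heytingField = record
  { Carrier = ℂ
  ; _≈_ = _≈ᶜ_ ; _#_ = _#ᶜ_
  ; _+_ = _+ᶜ_ ; _*_ = _*ᶜ_ ; -_ = -ᶜ_ ; 0# = 0ᶜ ; 1# = 1ᶜ
  ; isHeytingField = ℂ-isHeytingField
  }

2#0 : 1ᶜ +ᶜ 1ᶜ #ᶜ 0ᶜ
2#0 = Pos⇒#ᶜ {1ᶜ +ᶜ 1ᶜ} {0ᶜ} (1ℚ , 0<1 , 0 , λ _ _ → ℚₚ.≤ᵇ⇒≤ _)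

open QSeries ℂ-heytingField public

-- From  |1 ± w| ≥ 1 ± Re w  and  2 (1 ± Re w) = (1 ± Re w)² + 1 - (Re w)².
away-from-0 : ∀ u v {ε} → 0ℚ < ε → ½ * ε ≤ u → (½ * ε) * (½ * ε) ≤ u * u + v * v
away-from-0 u v {ε} 0<ε h = cert _
  (0≤+ (0≤* (0≤-diff h) (0≤+ (0≤-diff h) (ℚₚ.<⇒≤ 0<ε))) (0≤sq v))
  (solve 3 (λ u v ε → u :* u :+ v :* v :- con ½ :* ε :* (con ½ :* ε)
    := (u :- con ½ :* ε) :* ((u :- con ½ :* ε) :+ ε) :+ v :* v) refl u v ε)

1-w#0 : ∀ w → normSq w <ᴿ 1ᴿ → 1ᶜ +ᶜ -ᶜ w #ᶜ 0ᶜ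
1-w#0 w@(x +i y) (ε , 0<ε , h) = Pos⇒#ᶜ {1ᶜ +ᶜ -ᶜ w} {0ᶜ}
  ((½ * ε) * (½ * ε) , 0<* (0<half 0<ε) (0<half 0<ε) , evmap (λ n p → let a = seq x n; b = seq y n in
    away-from-0 (1ℚ + - a + - 0ℚ) (0ℚ + - b + - 0ℚ) 0<ε
      (cert _ (0≤+ (0≤* 0≤½ (0≤-diff p)) (0≤* 0≤½ (0≤+ (0≤sq (1ℚ - a)) (0≤sq b))))
        (solve 3 (λ a b ε → con 1ℚ :+ (:- a) :+ (:- con 0ℚ) :- con ½ :* ε
          := con ½ :* (con 1ℚ :- (a :* a :+ b :* b :+ ε))
          :+ con ½ :* ((con 1ℚ :- a) :* (con 1ℚ :- a) :+ b :* b)) refl a b ε))) h)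

1+w#0 : ∀ w → normSq w <ᴿ 1ᴿ → 1ᶜ +ᶜ w #ᶜ 0ᶜ
1+w#0 w@(x +i y) (ε , 0<ε , h) = Pos⇒#ᶜ {1ᶜ +ᶜ w} {0ᶜ}
  ((½ * ε) * (½ * ε) , 0<* (0<half 0<ε) (0<half 0<ε) , evmap (λ n p → let a = seq x n; b = seq y n in
    away-from-0 (1ℚ + a + - 0ℚ) (0ℚ + b + - 0ℚ) 0<ε
      (cert _ (0≤+ (0≤* 0≤½ (0≤-diff p)) (0≤* 0≤½ (0≤+ (0≤sq (1ℚ + a)) (0≤sq b))))
        (solve 3 (λ a b ε → con 1ℚ :+ a :+ (:- con 0ℚ) :- con ½ :* ε
          := con ½ :* (con 1ℚ :- (a :* a :+ b :* b :+ ε))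
          :+ con ½ :* ((con 1ℚ :+ a) :* (con 1ℚ :+ a) :+ b :* b)) refl a b ε))) h)

normSq-*-<1 : ∀ z w → normSq z <ᴿ 1ᴿ → Eventually (λ n → seq (normSq w) n ≤ 1ℚ) →
              normSq (z *ᶜ w) <ᴿ 1ᴿ
normSq-*-<1 z w (ε , 0<ε , h) k = ε , 0<ε , both (λ n p q →
    subst (λ t → t + ε ≤ 1ℚ) (sym (normSq-* z w n))
      (cert _ (0≤+ (0≤-diff p) (0≤* (0≤normSq z n) (0≤-diff q)))
        (solve 3 (λ z w ε → con 1ℚ :- (z :* w :+ ε) := (con 1ℚ :- (z :+ ε)) :+ z :* (con 1ℚ :- w))
          refl (seq (normSq z) n) (seq (normSq w) n) ε)))
  h k

<1⇒≤1 : ∀ z → normSq z <ᴿ 1ᴿ → Eventually (λ n → seq (normSq z) n ≤ 1ℚ)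
<1⇒≤1 z (ε , 0<ε , h) = evmap (λ n → ℚₚ.≤-trans (≤-+ʳ (seq (normSq z) n) (ℚₚ.<⇒≤ 0<ε))) h

normSq-^-<1 : ∀ q → normSq q <ᴿ 1ᴿ → ∀ k → normSq (q ^ suc k) <ᴿ 1ᴿ
normSq-^-<1 q h zero    = normSq-*-<1 q 1ᶜ h (0 , λ _ _ → ℚₚ.≤ᵇ⇒≤ _)
normSq-^-<1 q h (suc k) = normSq-*-<1 q (q ^ suc k) h (<1⇒≤1 (q ^ suc k) (normSq-^-<1 q h k))

0<‖‖⇒#0 : ∀ q → 0ᴿ <ᴿ ‖ q ‖ → q #ᶜ 0ᶜ
0<‖‖⇒#0 q@(a +i b) h = Pos⇒#ᶜ {q} {0ᶜ} (Pos-resp {normSq q} {normSq (q +ᶜ -ᶜ 0ᶜ)}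
  (pointwise {normSq q} {normSq (q +ᶜ -ᶜ 0ᶜ)} λ n →
    solve 2 (λ a b → a :* a :+ b :* b
      := (a :+ (:- con 0ℚ)) :* (a :+ (:- con 0ℚ)) :+ (b :+ (:- con 0ℚ)) :* (b :+ (:- con 0ℚ)))
      refl (seq a n) (seq b n))
  (sqrt-0< (normSq q) (0≤normSq q) h))

opaque
  punctured-disc : ∀ q → 0ᴿ <ᴿ ‖ q ‖ → ‖ q ‖ <ᴿ 1ᴿ → IsBase q
  punctured-disc q 0<∣q∣ ∣q∣<1 = record
    { q#0    = 0<‖‖⇒#0 q 0<∣q∣
    ; 1-qᵏ#0 = λ k → 1-w#0 (q ^ suc k) (normSq-^-<1 q N<1 k)
    ; 1+qᵏ#0 = λ k → 1+w#0 (q ^ suc k) (normSq-^-<1 q N<1 k)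
    }
    where
    N<1 : normSq q <ᴿ 1ᴿ
    N<1 = sqrt-<1 (normSq q) (0≤normSq q) ∣q∣<1

{-# OPTIONS --safe #-}
module Submission where

-- As a rational function of b, (1 - q²) Uₙ / (1 - q⁴ⁿ⁺²) has only simple poles, at
-- b = q⁻ⁱ for i ≤ n, and its partial fraction coefficients α n i have a closed form: both
-- sides of the expansion satisfy the same first-order recurrence in n.  The even
-- part in b replaces 1/(1 - b qⁱ) by 1/(1 - b² q²ⁱ).  Exchanging the sums, the
-- coefficient of 1/(1 - b² q²ⁱ) in the Bailey sum is a single terminating sum over j,
-- which q-Zeilberger telescoping evaluates; the result is the corresponding coefficient
-- of U₂₍ₙ₎, again by a recurrence in n.

open import Algebra.Apartness.Bundles using (HeytingCommutativeRing; HeytingField)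
import Algebra.Apartness.Properties.HeytingCommutativeRing
open import Algebra.Bundles using (CommutativeRing)
import Algebra.Properties.Ring
import Algebra.Properties.Semiring.Exp
import Algebra.Properties.Semiring.Mult.TCOptimised
import Algebra.Properties.Semiring.Sum
import Algebra.Solver.Ring
open import Algebra.Solver.Ring.AlmostCommutativeRing
  using (fromCommutativeRing; _-Raw-AlmostCommutative⟶_)
open import Data.Fin.Base using (toℕ)
import Data.Fin.Properties as Fin
open import Data.Integer.Base as ℤ using (ℤ; +_; -[1+_])
import Data.Integer.Properties as ℤ
open import Data.Maybe.Base as Maybe using ()
open import Data.Nat.Base as ℕ using (ℕ; zero; suc; z≤n; s≤s)
open import Data.Nat.Divisibility using (divides-refl)
import Data.Nat.DivMod as ℕ
import Data.Nat.Properties as ℕ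
open import Data.Product.Base using (_,_; proj₂)
open import Relation.Binary.PropositionalEquality as ≡ using (_≡_)
import Relation.Binary.Reasoning.Setoid
open import Relation.Nullary.Decidable using (dec⇒maybe)
open import Defs using (module QSeries)

-- The inner sum of Uₙ makes the Bailey sum a double sum with b in nearly every factor. The
-- expansion in 1/(1 - b qⁱ) replaces it by coefficients that are products free of b, so the claim
-- splits into one identity between single sums for each i.
--
-- The constant 2 in Uₙ is what makes the expansion hold: the recurrence of the fractions has the
-- defect σ(n+1) - q²ⁿ σ(n) = 2 σ(n+1), and each new term of the inner sum contributes exactly this.
--
-- Division needs a proof of apartness, so recurrences stay multiplied out, q⁻¹ is an element u with
-- q u = 1, and 1/(p;p)ₙ₋ᵢ is continued by 0 to i > n. These zeros allow any summation range longer
-- than n: sums for n and n + 1 share a range, the exchange of sums runs over a square, and upper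
-- boundary terms of telescoping sums vanish.

-- A ring solver with integer coefficients

module IntegerCoefficients {c ℓ} (R : CommutativeRing c ℓ) where
  open CommutativeRing R
  open Algebra.Properties.Ring ring
    using (-‿distribˡ-*; -‿distribʳ-*; -‿involutive; -‿+-comm; -0#≈0#)
  open Algebra.Properties.Semiring.Mult.TCOptimised semiring
    using (_×_; ×-homo-+; ×1-homo-*; 1+×)
  open Relation.Binary.Reasoning.Setoid setoid

  -- Integers serve as coefficients because their equality is decidable, while that of the carrier
  -- need not be. With the optimised multiple, `1 × 1#` reduces to `1#`, so `con (+ 1)` denotes `1#`
  -- itself.
  ⟦_⟧ : ℤ → Carrier
  ⟦ + n ⟧      = n × 1#
  ⟦ -[1+ n ] ⟧ = - (suc n × 1#)

  ⟦⟧-neg : ∀ n → ⟦ ℤ.- + n ⟧ ≈ - (n × 1#)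
  ⟦⟧-neg zero    = sym -0#≈0#
  ⟦⟧-neg (suc n) = refl

  -‿homo : ∀ i → ⟦ ℤ.- i ⟧ ≈ - ⟦ i ⟧
  -‿homo (+ n)    = ⟦⟧-neg n
  -‿homo -[1+ n ] = sym (-‿involutive _)

  ⊖-homo : ∀ m n → ⟦ m ℤ.⊖ n ⟧ ≈ m × 1# - n × 1#
  ⊖-homo m       zero    = sym (trans (+-congˡ -0#≈0#) (+-identityʳ _))
  ⊖-homo zero    (suc n) = sym (+-identityˡ _)
  ⊖-homo (suc m) (suc n) = begin
    ⟦ suc m ℤ.⊖ suc n ⟧                ≡⟨ ≡.cong ⟦_⟧ (ℤ.[1+m]⊖[1+n]≡m⊖n m n) ⟩
    ⟦ m ℤ.⊖ n ⟧                        ≈⟨ ⊖-homo m n ⟩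
    m × 1# - n × 1#                    ≈⟨ +-congʳ (+-identityʳ _) ⟨
    m × 1# + 0# - n × 1#               ≈⟨ +-congʳ (+-congˡ (-‿inverseʳ 1#)) ⟨
    m × 1# + (1# - 1#) - n × 1#        ≈⟨ +-congʳ (+-assoc _ _ _) ⟨
    m × 1# + 1# - 1# - n × 1#          ≈⟨ +-assoc _ _ _ ⟩
    m × 1# + 1# + (- 1# - n × 1#)      ≈⟨ +-cong (+-comm _ _) (-‿+-comm _ _) ⟩
    1# + m × 1# - (1# + n × 1#)        ≈⟨ +-cong (1+× m 1#) (-‿cong (1+× n 1#)) ⟨
    suc m × 1# - suc n × 1#            ∎

  +-homo : ∀ i j → ⟦ i ℤ.+ j ⟧ ≈ ⟦ i ⟧ + ⟦ j ⟧
  +-homo (+ m)    (+ n)    = ×-homo-+ 1# m n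
  +-homo (+ m)    -[1+ n ] = ⊖-homo m (suc n)
  +-homo -[1+ m ] (+ n)    = trans (⊖-homo n (suc m)) (+-comm _ _)
  +-homo -[1+ m ] -[1+ n ] = begin
    - (suc (suc (m ℕ.+ n)) × 1#)       ≡⟨ ≡.cong (λ k → - (suc k × 1#)) (ℕ.+-suc m n) ⟨
    - ((suc m ℕ.+ suc n) × 1#)         ≈⟨ -‿cong (×-homo-+ 1# (suc m) (suc n)) ⟩
    - (suc m × 1# + suc n × 1#)        ≈⟨ -‿+-comm _ _ ⟨
    - (suc m × 1#) - suc n × 1#        ∎

  +*-homo : ∀ m j → ⟦ + m ℤ.* j ⟧ ≈ m × 1# * ⟦ j ⟧
  +*-homo m (+ n)    = trans (reflexive (≡.cong ⟦_⟧ (≡.sym (ℤ.pos-* m n)))) (×1-homo-* m n)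
  +*-homo m -[1+ n ] = begin
    ⟦ + m ℤ.* -[1+ n ] ⟧          ≡⟨ ≡.cong ⟦_⟧ (ℤ.neg-distribʳ-* (+ m) (+ suc n)) ⟨
    ⟦ ℤ.- (+ m ℤ.* + suc n) ⟧     ≈⟨ -‿homo (+ m ℤ.* + suc n) ⟩
    - ⟦ + m ℤ.* + suc n ⟧         ≈⟨ -‿cong (+*-homo m (+ suc n)) ⟩
    - (m × 1# * suc n × 1#)       ≈⟨ -‿distribʳ-* _ _ ⟩
    m × 1# * - (suc n × 1#)       ∎

  *-homo : ∀ i j → ⟦ i ℤ.* j ⟧ ≈ ⟦ i ⟧ * ⟦ j ⟧
  *-homo (+ m)    j = +*-homo m j
  *-homo -[1+ m ] j = begin
    ⟦ -[1+ m ] ℤ.* j ⟧            ≡⟨ ≡.cong ⟦_⟧ (ℤ.neg-distribˡ-* (+ suc m) j) ⟨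
    ⟦ ℤ.- (+ suc m ℤ.* j) ⟧       ≈⟨ -‿homo (+ suc m ℤ.* j) ⟩
    - ⟦ + suc m ℤ.* j ⟧           ≈⟨ -‿cong (+*-homo (suc m) j) ⟩
    - (suc m × 1# * ⟦ j ⟧)        ≈⟨ -‿distribˡ-* _ _ ⟩
    - (suc m × 1#) * ⟦ j ⟧        ∎

  ℤ⟶R : CommutativeRing.rawRing ℤ.+-*-commutativeRing
          -Raw-AlmostCommutative⟶ fromCommutativeRing R
  ℤ⟶R = record
    { ⟦_⟧ = ⟦_⟧ ; +-homo = +-homo ; *-homo = *-homo ; -‿homo = -‿homo
    ; 0-homo = refl ; 1-homo = refl }

  open Algebra.Solver.Ring _ _ ℤ⟶R
    (λ i j → Maybe.map (λ i≡j → reflexive (≡.cong ⟦_⟧ i≡j)) (dec⇒maybe (i ℤ.≟ j)))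
    public using (solve; con; _:=_; _:+_; _:*_; _:-_; :-_)

-- Finite sums over initial segments of ℕ

module RangeSums {c ℓ} (R : CommutativeRing c ℓ) where
  open CommutativeRing R
  open Algebra.Properties.Semiring.Sum semiring
    using (sum; sum-cong-≋; ∑-distrib-+; ∑-comm; *-distribˡ-sum)
  open IntegerCoefficients R
  open Relation.Binary.Reasoning.Setoid setoid

  ∑ : ℕ → (ℕ → Carrier) → Carrier
  ∑ n f = sum {n} λ i → f (toℕ i)

  ∑-cong : ∀ n {f g} → (∀ i → i ℕ.< n → f i ≈ g i) → ∑ n f ≈ ∑ n g
  ∑-cong n f≈g = sum-cong-≋ λ i → f≈g (toℕ i) (Fin.toℕ<n i)

  ∑-zero : ∀ n {f} → (∀ i → i ℕ.< n → f i ≈ 0#) → ∑ n f ≈ 0#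
  ∑-zero zero    f≈0 = refl
  ∑-zero (suc n) f≈0 = trans
    (+-cong (f≈0 0 (s≤s z≤n)) (∑-zero n λ i i<n → f≈0 (suc i) (s≤s i<n))) (+-identityʳ 0#)

  ∑-last : ∀ n f → ∑ (suc n) f ≈ ∑ n f + f n
  ∑-last zero    f = +-comm (f 0) 0#
  ∑-last (suc n) f = trans (+-congˡ (∑-last n λ i → f (suc i))) (sym (+-assoc _ _ _))

  ∑-+ : ∀ n f g → ∑ n (λ i → f i + g i) ≈ ∑ n f + ∑ n g
  ∑-+ n f g = ∑-distrib-+ {n} (λ i → f (toℕ i)) (λ i → g (toℕ i))

  ∑-*ˡ : ∀ n x f → x * ∑ n f ≈ ∑ n (λ i → x * f i)
  ∑-*ˡ n x f = *-distribˡ-sum {n} x (λ i → f (toℕ i))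

  ∑-swap : ∀ m n (f : ℕ → ℕ → Carrier) →
           ∑ m (λ i → ∑ n (f i)) ≈ ∑ n (λ j → ∑ m λ i → f i j)
  ∑-swap m n f = ∑-comm {m} {n} λ i j → f (toℕ i) (toℕ j)

  ∑-linear : ∀ n x y f g → ∑ n (λ i → x * f i + y * g i) ≈ x * ∑ n f + y * ∑ n g
  ∑-linear n x y f g = trans (∑-+ n (λ i → x * f i) λ i → y * g i)
    (sym (+-cong (∑-*ˡ n x f) (∑-*ˡ n y g)))

  ∑-telescope : ∀ n {f : ℕ → Carrier} (g : ℕ → Carrier) →
                (∀ i → f i ≈ g (suc i) - g i) → ∑ n f ≈ g n - g 0
  ∑-telescope zero    g f≈Δg = sym (-‿inverseʳ (g 0))
  ∑-telescope (suc n) {f} g f≈Δg = begin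
    ∑ (suc n) f                          ≈⟨ ∑-last n f ⟩
    ∑ n f + f n                          ≈⟨ +-cong (∑-telescope n g f≈Δg) (f≈Δg n) ⟩
    g n - g 0 + (g (suc n) - g n)        ≈⟨ solve 3 (λ a b c → b :- a :+ (c :- b) := c :- a)
                                              refl (g 0) (g n) (g (suc n)) ⟩
    g (suc n) - g 0                      ∎

-- Reciprocals and shifted factorials in a Heyting field

module FieldLemmas {c ℓ₁ ℓ₂} (K : HeytingField c ℓ₁ ℓ₂) where
  open HeytingField K public hiding (setoid; zero)
  open QSeries K public
  open Algebra.Apartness.Properties.HeytingCommutativeRing heytingCommutativeRing public
    using (x-0≈x; #-congʳ; invertibleʳ⇒#)

  R : CommutativeRing c ℓ₁
  R = HeytingCommutativeRing.commutativeRing heytingCommutativeRing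

  open CommutativeRing R public using (semiring; setoid)
  open IntegerCoefficients R public using (solve; con; _:=_; _:+_; _:*_; _:-_; :-_)
  open RangeSums R public
  open Algebra.Properties.Semiring.Exp semiring public using (^-homo-*; ^-assocʳ; ^-congʳ)
  open Relation.Binary.Reasoning.Setoid setoid

  -- Equations modulo relations a ≈ b: the solver establishes  l ≈ r + ∑ k (a - b).
  mod₁ : ∀ {l r k a b} → l ≈ r + k * (a - b) → a ≈ b → l ≈ r
  mod₁ {l} {r} {k} {a} {b} h a≈b = begin
    l                  ≈⟨ h ⟩
    r + k * (a - b)    ≈⟨ +-congˡ (*-congˡ (+-congʳ a≈b)) ⟩
    r + k * (b - b)    ≈⟨ solve 3 (λ r k b → r :+ k :* (b :- b) := r) refl r k b ⟩
    r                  ∎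

  mod₂ : ∀ {l r k a b k′ a′ b′} → l ≈ r + k * (a - b) + k′ * (a′ - b′) → a ≈ b → a′ ≈ b′ → l ≈ r
  mod₂ h a≈b a′≈b′ = mod₁ (mod₁ h a′≈b′) a≈b

  mod₃ : ∀ {l r k a b k′ a′ b′ k″ a″ b″} →
         l ≈ r + k * (a - b) + k′ * (a′ - b′) + k″ * (a″ - b″) →
         a ≈ b → a′ ≈ b′ → a″ ≈ b″ → l ≈ r
  mod₃ h a≈b a′≈b′ a″≈b″ = mod₂ (mod₁ h a″≈b″) a≈b a′≈b′

  annihilateˡ : ∀ {x y} → x ≈ 0# → x * y ≈ 0#
  annihilateˡ x≈0 = trans (*-congʳ x≈0) (zeroˡ _)

  annihilateʳ : ∀ {x y} → y ≈ 0# → x * y ≈ 0#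
  annihilateʳ y≈0 = trans (*-congˡ y≈0) (zeroʳ _)

  inverseʳ : ∀ x (x#0 : x # 0#) → x * inverse x x#0 ≈ 1#
  inverseʳ x x#0 = trans (*-congʳ (sym (x-0≈x x))) (proj₂ (proj₂ (#⇒invertible x#0)))

  -- `inverse` takes an apartness proof as argument, so reciprocals are compared through their
  -- products with a common x.
  inverse-unique : ∀ {x y z} → x * y ≈ 1# → x * z ≈ 1# → y ≈ z
  inverse-unique {x} {y} {z} xy≈1 xz≈1 = mod₂
    (solve 3 (λ x y z → y := z :+ z :* (x :* y :- con (+ 1)) :+ (:- y) :* (x :* z :- con (+ 1)))
      refl x y z) xy≈1 xz≈1

  *-cancelˡ-# : ∀ {x y z} → x # 0# → x * y ≈ x * z → y ≈ z
  *-cancelˡ-# {x} {y} {z} x#0 xy≈xz = mod₂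
    (solve 4 (λ x i y z → y := z :+ i :* (x :* y :- x :* z) :+ (z :- y) :* (x :* i :- con (+ 1)))
      refl x (inverse x x#0) y z) xy≈xz (inverseʳ x x#0)

  -- The inverse of y is x / (x y). Many denominators are given apart from 0 only as whole products;
  -- this recovers a single factor.
  #0-factorʳ : ∀ {x y} → x * y # 0# → y # 0#
  #0-factorʳ {x} {y} xy#0 = invertibleʳ⇒# (x * inverse (x * y) xy#0 , (begin
    (y - 0#) * (x * i)   ≈⟨ *-congʳ (x-0≈x y) ⟩
    y * (x * i)          ≈⟨ solve 3 (λ x y i → y :* (x :* i) := x :* y :* i) refl x y i ⟩
    x * y * i            ≈⟨ inverseʳ (x * y) xy#0 ⟩
    1#                   ∎))
    where
    i = inverse (x * y) xy#0

  ^-inverse : ∀ {p v} → p * v ≈ 1# → ∀ n → p ^ n * v ^ n ≈ 1#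
  ^-inverse pv≈1 zero = *-identityˡ 1#
  ^-inverse {p} {v} pv≈1 (suc n) = mod₂
    (solve 4 (λ p v P V → p :* P :* (v :* V) := con (+ 1) :+ P :* V :* (p :* v :- con (+ 1))
        :+ con (+ 1) :* (P :* V :- con (+ 1))) refl p v (p ^ n) (v ^ n))
    pv≈1 (^-inverse pv≈1 n)

  poch-sucˡ : ∀ z p n → poch z p (suc n) ≈ (1# - z) * poch (z * p) p n
  poch-sucˡ z p zero = solve 1 (λ z → con (+ 1) :* (con (+ 1) :- z :* con (+ 1))
    := (con (+ 1) :- z) :* con (+ 1)) refl z
  poch-sucˡ z p (suc n) = begin
    poch z p (suc n) * (1# - z * (p * p ^ n))
      ≈⟨ *-cong (poch-sucˡ z p n) (+-congˡ (-‿cong (sym (*-assoc z p (p ^ n))))) ⟩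
    (1# - z) * poch (z * p) p n * (1# - z * p * p ^ n)
      ≈⟨ *-assoc _ _ _ ⟩
    (1# - z) * poch (z * p) p (suc n)
      ∎

triangular : ℕ → ℕ
triangular n = n ℕ.* (n ℕ.∸ 1) ℕ./ 2

-- Truncated division distributes over this sum because the second summand n * 2 is even.
triangular-suc : ∀ n → triangular (suc n) ≡ triangular n ℕ.+ n
triangular-suc n = begin
  suc n ℕ.* n ℕ./ 2                       ≡⟨ ≡.cong (ℕ._/ 2) (split n) ⟩
  (n ℕ.* (n ℕ.∸ 1) ℕ.+ n ℕ.* 2) ℕ./ 2     ≡⟨ ℕ.+-distrib-/-∣ʳ (n ℕ.* (n ℕ.∸ 1)) (divides-refl n) ⟩
  triangular n ℕ.+ n ℕ.* 2 ℕ./ 2          ≡⟨ ≡.cong (triangular n ℕ.+_) (ℕ.m*n/n≡m n 2) ⟩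
  triangular n ℕ.+ n                      ∎
  where
  open ≡.≡-Reasoning
  split : ∀ n → suc n ℕ.* n ≡ n ℕ.* (n ℕ.∸ 1) ℕ.+ n ℕ.* 2
  split zero    = ≡.refl
  split (suc m) = ≡.trans (≡.cong (ℕ._* suc m) (ℕ.+-comm 2 m)) (≡.trans (ℕ.*-distribʳ-+ (suc m) m 2)
    (≡.cong₂ ℕ._+_ (ℕ.*-comm m (suc m)) (ℕ.*-comm 2 (suc m))))

module QSeriesIdentities {c ℓ₁ ℓ₂} (K : HeytingField c ℓ₁ ℓ₂) where
  open FieldLemmas K
  open Relation.Binary.Reasoning.Setoid setoid

  -- Reciprocal factorials and the partial fractions of (-c B)ⁿ p^(n(n-1)/2) / (B ; p)ₙ₊₁

  module Base {p v : Carrier} (pv≈1 : p * v ≈ 1#) (p#0 : ∀ n → poch p p n # 0#) where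

    1/[_]! : ℕ → Carrier
    1/[ n ]! = inverse (poch p p n) (p#0 n)

    1/!-0 : 1/[ 0 ]! ≈ 1#
    1/!-0 = trans (sym (*-identityˡ _)) (inverseʳ 1# (p#0 0))

    1/!-suc : ∀ n → 1/[ n ]! ≈ (1# - p * p ^ n) * 1/[ suc n ]!
    1/!-suc n = inverse-unique (inverseʳ _ (p#0 n))
      (trans (sym (*-assoc _ _ _)) (inverseʳ _ (p#0 (suc n))))

    -- 1 / (p ; p)ₙ₋ᵢ, read as 0 for i > n.
    1/[_∸_]! : ℕ → ℕ → Carrier
    1/[ n     ∸ zero  ]! = 1/[ n ]!
    1/[ zero  ∸ suc i ]! = 0#
    1/[ suc n ∸ suc i ]! = 1/[ n ∸ i ]!

    1/∸!-∸ : ∀ {n i} → i ℕ.≤ n → 1/[ n ∸ i ]! ≡ 1/[ n ℕ.∸ i ]!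
    1/∸!-∸ z≤n       = ≡.refl
    1/∸!-∸ (s≤s i≤n) = 1/∸!-∸ i≤n

    1/∸!-> : ∀ {n i} → n ℕ.< i → 1/[ n ∸ i ]! ≡ 0#
    1/∸!-> {zero}  {suc i} n<i       = ≡.refl
    1/∸!-> {suc n} {suc i} (s≤s n<i) = 1/∸!-> n<i

    -- At i = n + 1 the factor 1 - pⁿ⁺¹⁻ⁱ vanishes, in agreement with the value 0 on the left, and
    -- beyond that both sides are 0. So no range condition on i is needed.
    1/∸!-suc : ∀ n i → 1/[ n ∸ i ]! ≈ (1# - p * p ^ n * v ^ i) * 1/[ suc n ∸ i ]!
    1/∸!-suc n zero = trans (1/!-suc n)
      (*-congʳ (+-congˡ (-‿cong (sym (*-identityʳ (p * p ^ n))))))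
    1/∸!-suc zero (suc zero) = mod₁
      (solve 3 (λ p v w → let 1# = con (+ 1) in
          con (+ 0) := (1# :- p :* 1# :* (v :* 1#)) :* w :+ w :* (p :* v :- 1#))
        refl p v 1/[ 0 ]!) pv≈1
    1/∸!-suc zero (suc (suc i)) = sym (zeroʳ _)
    1/∸!-suc (suc n) (suc i) = trans (1/∸!-suc n i) (*-congʳ (+-congˡ (-‿cong (mod₁
      (solve 4 (λ p v P V →
          p :* P :* V := p :* (p :* P) :* (v :* V) :+ (:- (p :* P :* V)) :* (p :* v :- con (+ 1)))
        refl p v (p ^ n) (v ^ i)) pv≈1))))

    module Weight (c : Carrier) where

      -- (-1)ⁿ⁺ⁱ cⁿ p^(n(n-1)/2 - n i + i(i+1)/2)
      weight : ℕ → ℕ → Carrier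
      weight zero    zero    = 1#
      weight zero    (suc i) = - (p ^ suc i * weight zero i)
      weight (suc n) i       = - (p ^ n * c * v ^ i * weight n i)

      -- The definition recurses on i only at n = 0. In general the exponent of p grows by i + 1 -
      -- n: i(i+1)/2 gains i + 1 and n i gains n.
      weight-sucʳ : ∀ n i → weight n (suc i) ≈ - (p ^ suc i * v ^ n * weight n i)
      weight-sucʳ zero i = -‿cong (*-congʳ (sym (*-identityʳ (p ^ suc i))))
      weight-sucʳ (suc n) i = trans (-‿cong (*-congˡ (weight-sucʳ n i)))
        (solve 8 (λ p v c P V P′ V′ w →
            :- (P :* c :* (v :* V′) :* :- (p :* P′ :* V :* w))
              := :- (p :* P′ :* (v :* V) :* :- (P :* c :* V′ :* w)))
          refl p v c (p ^ n) (v ^ n) (p ^ i) (v ^ i) (weight n i))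

      -- The exponent of p vanishes at n = i. Hence the weights in base q and in base q² with the
      -- same c agree on the diagonal, which is what the initial case of the Bailey sum needs.
      weight-diagonal : ∀ i → weight i i ≈ c ^ i
      weight-diagonal zero    = refl
      weight-diagonal (suc i) = begin
        - (P * c * (v * V) * weight i (suc i))
          ≈⟨ -‿cong (*-congˡ (weight-sucʳ i i)) ⟩
        - (P * c * (v * V) * - (p * P * V * weight i i))
          ≈⟨ mod₂ (solve 6 (λ p v c P V w →
               :- (P :* c :* (v :* V) :* :- (p :* P :* V :* w)) := c :* w
                 :+ c :* w :* (p :* v :- con (+ 1))
                 :+ c :* w :* (p :* v) :* (P :* V :+ con (+ 1)) :* (P :* V :- con (+ 1)))
             refl p v c P V (weight i i)) pv≈1 (^-inverse pv≈1 i) ⟩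
        c * weight i i
          ≈⟨ *-congˡ (weight-diagonal i) ⟩
        c * c ^ i
          ∎
        where
        P = p ^ i
        V = v ^ i

      -- The coefficient of  1 / (1 - B pⁱ)  in  (-c B)ⁿ p^(n(n-1)/2) / (B ; p)ₙ₊₁.
      residue : ℕ → ℕ → Carrier
      residue n i = weight n i * 1/[ n ∸ i ]! * 1/[ i ]!

      residue-suc : ∀ n i → residue (suc n) i * (p ^ i - p * p ^ n) ≈ - (p ^ n * c * residue n i)
      residue-suc n i = mod₂ (solve 9 (λ p c P P′ V w r r′ k →
          :- (P :* c :* V :* w) :* r′ :* k :* (P′ :- p :* P)
            := :- (P :* c :* (w :* r :* k))
              :+ P :* c :* w :* k :* (r :- (con (+ 1) :- p :* P :* V) :* r′)
              :+ (:- (P :* c :* w :* r′ :* k)) :* (P′ :* V :- con (+ 1)))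
        refl p c (p ^ n) (p ^ i) (v ^ i) (weight n i) 1/[ n ∸ i ]! 1/[ suc n ∸ i ]! 1/[ i ]!)
        (1/∸!-suc n i) (^-inverse pv≈1 i)

      -- The sum is the value at B = 0 of the function being expanded, which has a zero there since
      -- n + 1 ≥ 1. The proof telescopes: in `G` the factor pⁱ - 1 kills the lower end and a
      -- reciprocal factorial the upper one.
      ∑-residue : ∀ n M → suc n ℕ.< M → ∑ M (residue (suc n)) ≈ 0#
      ∑-residue n M 1+n<M = *-cancelˡ-# (#0-factorʳ (p#0 (suc n))) (begin
        (1# - p * p ^ n) * ∑ M (residue (suc n))            ≈⟨ ∑-*ˡ M _ (residue (suc n)) ⟩
        ∑ M (λ i → (1# - p * p ^ n) * residue (suc n) i)    ≈⟨ ∑-telescope M G step ⟩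
        G M - G 0                                           ≈⟨ +-cong GM≈0 (-‿cong G0≈0) ⟩
        0# - 0#                                             ≈⟨ -‿inverseʳ 0# ⟩
        0#                                                  ≈⟨ zeroʳ _ ⟨
        (1# - p * p ^ n) * 0#                               ∎)
        where
        G : ℕ → Carrier
        G i = p * p ^ n * v ^ i * (p ^ i - 1#) * residue (suc n) i

        GM≈0 : G M ≈ 0#
        GM≈0 = annihilateʳ (annihilateˡ (annihilateʳ (reflexive (1/∸!-> 1+n<M))))

        G0≈0 : G 0 ≈ 0#
        G0≈0 = annihilateˡ (annihilateʳ (-‿inverseʳ 1#))

        step : ∀ i → (1# - p * p ^ n) * residue (suc n) i ≈ G (suc i) - G i
        step i = sym (begin
          G (suc i) - G i
            ≈⟨ +-congʳ (*-congˡ (*-congʳ (*-congʳ (weight-sucʳ (suc n) i)))) ⟩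
          p * P * (v * V) * (p * Y - 1#) * (- (p * Y * (v * N) * w) * r₀ * k₁) - G i
            ≈⟨ +-congʳ (solve 10 (λ p v P N Y V w r₀ k₁ 1# →
                 p :* P :* (v :* V) :* (p :* Y :- 1#) :* (:- (p :* Y :* (v :* N) :* w) :* r₀ :* k₁)
                   := p :* v :* (p :* v) :* (Y :* V) :* (P :* N) :* (w :* r₀ :* ((1# :- p :* Y) :* k₁)))
                 refl p v P N Y V w r₀ k₁ 1#) ⟩
          p * v * (p * v) * (Y * V) * (P * N) * (w * r₀ * ((1# - p * Y) * k₁)) - G i
            ≈⟨ +-congʳ (*-cong
                 (*-cong (*-cong (*-cong pv≈1 pv≈1) (^-inverse pv≈1 i)) (^-inverse pv≈1 n))
                 (*-cong (*-congˡ (1/∸!-suc n i)) (sym (1/!-suc i)))) ⟩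
          1# * 1# * 1# * 1# * (w * ((1# - p * P * V) * r) * k) - G i
            ≈⟨ mod₁ (solve 7 (λ p P Y V w r k → let 1# = con (+ 1) in
                 1# :* 1# :* 1# :* 1# :* (w :* ((1# :- p :* P :* V) :* r) :* k)
                     :- p :* P :* V :* (Y :- 1#) :* (w :* r :* k)
                   := (1# :- p :* P) :* (w :* r :* k) :+ (:- (p :* P :* w :* r :* k)) :* (Y :* V :- 1#))
                 refl p P Y V w r k) (^-inverse pv≈1 i) ⟩
          (1# - p * P) * residue (suc n) i
            ∎)
          where
          P = p ^ n
          N = v ^ n
          Y = p ^ i
          V = v ^ i
          w = weight (suc n) i
          r = 1/[ suc n ∸ i ]!
          r₀ = 1/[ n ∸ i ]!
          k = 1/[ i ]!
          k₁ = 1/[ suc i ]!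

      module PartialFractions (B : Carrier) (κ : ℕ → Carrier)
                              ([1-Bpⁱ]κ≈1 : ∀ i → (1# - B * p ^ i) * κ i ≈ 1#) where

        fractions : ℕ → ℕ → Carrier
        fractions M n = ∑ M λ i → residue n i * κ i

        numerator : ℕ → Carrier
        numerator zero    = 1#
        numerator (suc n) = - (p ^ n * c * B) * numerator n

        fractions-0 : ∀ M → (1# - B * p ^ 0) * fractions (suc M) 0 ≈ 1#
        fractions-0 M = begin
          (1# - B * p ^ 0) * (1# * 1/[ 0 ]! * 1/[ 0 ]! * κ 0 + ∑ M (λ i → residue 0 (suc i) * κ (suc i)))
            ≈⟨ *-congˡ (+-cong (*-congʳ (*-cong (*-congˡ 1/!-0) 1/!-0))
                 (∑-zero M {λ i → residue 0 (suc i) * κ (suc i)} λ i _ →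
                   annihilateˡ (annihilateˡ (zeroʳ _)))) ⟩
          (1# - B * p ^ 0) * (1# * 1# * 1# * κ 0 + 0#)
            ≈⟨ solve 2 (λ x k → x :* (con (+ 1) :* con (+ 1) :* con (+ 1) :* k :+ con (+ 0)) := x :* k)
                 refl (1# - B * p ^ 0) (κ 0) ⟩
          (1# - B * p ^ 0) * κ 0
            ≈⟨ [1-Bpⁱ]κ≈1 0 ⟩
          1# ∎

        -- Write 1 - B pⁿ⁺¹ = (1 - B pⁱ) + B (pⁱ - pⁿ⁺¹). The first part cancels `κ i` and leaves
        -- the residue; the second cancels against the term at n by `residue-suc`. The defect is
        -- thus the sum of the residues, which is 0.
        fractions-suc : ∀ n M → suc n ℕ.< M →
          (1# - B * p ^ suc n) * fractions M (suc n) ≈ - (p ^ n * c * B) * fractions M n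
        fractions-suc n M 1+n<M = mod₁
          (solve 4 (λ x F′ y F → x :* F′ := :- y :* F :+ con (+ 1) :* (x :* F′ :+ y :* F :- con (+ 0)))
            refl (1# - B * p ^ suc n) (fractions M (suc n)) (p ^ n * c * B) (fractions M n))
          (begin
            (1# - B * p ^ suc n) * fractions M (suc n) + p ^ n * c * B * fractions M n
              ≈⟨ ∑-linear M _ _ (λ i → residue (suc n) i * κ i) (λ i → residue n i * κ i) ⟨
            ∑ M (λ i → (1# - B * p ^ suc n) * (residue (suc n) i * κ i) + p ^ n * c * B * (residue n i * κ i))
              ≈⟨ ∑-cong M (λ i _ → step i) ⟩
            ∑ M (residue (suc n))
              ≈⟨ ∑-residue n M 1+n<M ⟩
            0# ∎)
          where
          step : ∀ i → (1# - B * p ^ suc n) * (residue (suc n) i * κ i) + p ^ n * c * B * (residue n i * κ i)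
                       ≈ residue (suc n) i
          step i = mod₂
            (solve 8 (λ p c P Y B κ r r′ → let 1# = con (+ 1) in
                (1# :- B :* (p :* P)) :* (r′ :* κ) :+ P :* c :* B :* (r :* κ)
                  := r′ :+ κ :* B :* (r′ :* (Y :- p :* P) :- :- (P :* c :* r))
                        :+ r′ :* ((1# :- B :* Y) :* κ :- 1#))
              refl p c (p ^ n) (p ^ i) B (κ i) (residue n i) (residue (suc n) i))
            (residue-suc n i) ([1-Bpⁱ]κ≈1 i)

        fractions-closed : ∀ n M → n ℕ.< M → poch B p (suc n) * fractions M n ≈ numerator n
        fractions-closed zero    (suc M) _ = trans (*-congʳ (*-identityˡ _)) (fractions-0 M)
        fractions-closed (suc n) M 1+n<M = begin
          poch B p (suc n) * (1# - B * p ^ suc n) * fractions M (suc n)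
            ≈⟨ *-assoc _ _ _ ⟩
          poch B p (suc n) * ((1# - B * p ^ suc n) * fractions M (suc n))
            ≈⟨ *-congˡ (fractions-suc n M 1+n<M) ⟩
          poch B p (suc n) * (- (p ^ n * c * B) * fractions M n)
            ≈⟨ solve 3 (λ x y z → x :* (y :* z) := y :* (x :* z)) refl
                 (poch B p (suc n)) (- (p ^ n * c * B)) (fractions M n) ⟩
          - (p ^ n * c * B) * (poch B p (suc n) * fractions M n)
            ≈⟨ *-congˡ (fractions-closed n M (ℕ.<-trans (ℕ.n<1+n n) 1+n<M)) ⟩
          - (p ^ n * c * B) * numerator n
            ∎

  -- The coefficients α of Uₙ, their recurrence and their sum

  module Coefficients {q : Carrier} (base : IsBase q) where
    open IsBase base public

    q² u : Carrier
    q² = q ^ 2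
    u = inverse q q#0

    qu≈1 : q * u ≈ 1#
    qu≈1 = inverseʳ q q#0

    q²u²≈1 : q² * u ^ 2 ≈ 1#
    q²u²≈1 = ^-inverse qu≈1 2

    module Q = Base qu≈1 (poch#0 1-qᵏ#0)
    module P = Base q²u²≈1 ([q²]ₙ#0 base)
    module E = Q.Weight u
    module F = P.Weight u

    square-^ : ∀ x n → (x ^ 2) ^ n ≈ x ^ n * x ^ n
    square-^ x zero    = sym (*-identityˡ 1#)
    square-^ x (suc n) = trans (*-congˡ (square-^ x n))
      (solve 2 (λ x X → x :* (x :* con (+ 1)) :* (X :* X) := x :* X :* (x :* X)) refl x (x ^ n))

    -- The coefficient of  1 / (1 - b qⁱ)  in  (1 - q²) Uₙ / (1 - q⁴ⁿ⁺²), with the sum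
    -- over j in Uₙ at b = q⁻ⁱ evaluated by  ∑ⱼ (-1)ʲ q^(j²) / ((q)ᵢ₋ⱼ (q)ᵢ₊ⱼ) = 1 / (q² ; q²)ᵢ.
    α : ℕ → ℕ → Carrier
    α n i = E.weight n i * poch q q (n ℕ.+ i) * Q.1/[ n ∸ i ]! * P.1/[ i ]!

    private
      -- A common factor of α n i and α (n+1) i: with 1/(q;q)ₙ₊₁₋ᵢ in place of 1/(q;q)ₙ₋ᵢ, both are
      -- multiples of it, also at i = n + 1, where α n i is 0.
      core : ℕ → ℕ → Carrier
      core n i = E.weight n i * poch q q (n ℕ.+ i) * Q.1/[ suc n ∸ i ]! * P.1/[ i ]!

    α-core : ∀ n i → α n i ≈ (1# - q * q ^ n * u ^ i) * core n i
    α-core n i = trans (*-congʳ (*-congˡ (Q.1/∸!-suc n i)))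
      (solve 5 (λ e z x r k → e :* z :* (x :* r) :* k := x :* (e :* z :* r :* k)) refl _ _ _ _ _)

    α-suc-core : ∀ n i →
      α (suc n) i ≈ - (q ^ n * u * u ^ i) * (1# - q * (q ^ n * q ^ i)) * core n i
    α-suc-core n i = trans
      (*-congʳ (*-congʳ (*-congˡ (*-congˡ (+-congˡ (-‿cong (*-congˡ (^-homo-* q n i))))))))
      (solve 6 (λ x e z y r k → (:- (x :* e)) :* (z :* y) :* r :* k := (:- x) :* y :* (e :* z :* r :* k))
        refl _ _ _ _ _ _)

    α-> : ∀ {n i} → n ℕ.< i → α n i ≈ 0#
    α-> n<i = annihilateˡ (annihilateʳ (reflexive (Q.1/∸!-> n<i)))

    -- This is qⁱ times the recurrence in n of the prefactor of Uₙ, taken at the pole b = q⁻ⁱ. It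
    -- stays multiplied out because at i = n + 1 both sides vanish, so α (n+1) (n+1) cannot be
    -- obtained by division.
    α-suc : ∀ n i →
      (q ^ i - q * q ^ n) * α (suc n) i ≈ α n i * (q ^ n * q ^ n * q ^ i - q ^ n * u)
    α-suc n i = begin
      (Y - q * X) * α (suc n) i
        ≈⟨ *-congˡ (α-suc-core n i) ⟩
      (Y - q * X) * (- (X * u * V) * (1# - q * (X * Y)) * C)
        ≈⟨ mod₂ (solve 6 (λ q u X Y V C → let 1# = con (+ 1) in
             (Y :- q :* X) :* (:- (X :* u :* V) :* (1# :- q :* (X :* Y)) :* C)
               := (1# :- q :* X :* V) :* C :* (X :* X :* Y :- X :* u)
                 :+ (:- (X :* u :* (1# :- q :* (X :* Y)) :* C)) :* (Y :* V :- 1#)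
                 :+ (1# :- q :* X :* V) :* X :* X :* Y :* C :* (q :* u :- 1#))
           refl q u X Y V C) (^-inverse qu≈1 i) qu≈1 ⟩
      (1# - q * X * V) * C * (X * X * Y - X * u)
        ≈⟨ *-congʳ (α-core n i) ⟨
      α n i * (X * X * Y - X * u) ∎
      where
      X = q ^ n
      Y = q ^ i
      V = u ^ i
      C = core n i

    -- (-1)ⁿ q^(n² - n)
    σ : ℕ → Carrier
    σ zero    = 1#
    σ (suc n) = - (q ^ n * q ^ n * σ n)

    private
      -- The antidifference for the recurrence of ∑ᵢ α n i. The factor 1 - q²ⁱ kills i = 0 and,
      -- after the shift of i, lowers 1/(q²;q²)ᵢ₊₁ to 1/(q²;q²)ᵢ; the reciprocal factorial in `core`
      -- kills the upper end.
      certificate : ℕ → ℕ → Carrier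
      certificate n i = q ^ n * q ^ n * (u ^ i * u ^ i) * (1# - q ^ i * q ^ i) * core n i

      α-telescope : ∀ n i →
        α (suc n) i + q ^ n * q ^ n * α n i ≈ certificate n (suc i) - certificate n i
      α-telescope n i = begin
        α (suc n) i + X * X * α n i
          ≈⟨ +-cong (α-suc-core n i) (*-congˡ (α-core n i)) ⟩
        - (X * u * V) * (1# - q * (X * Y)) * C + X * X * ((1# - q * X * V) * C)
          ≈⟨ mod₂ (solve 6 (λ q u X Y V C → let 1# = con (+ 1) in
               :- (X :* u :* V) :* (1# :- q :* (X :* Y)) :* C :+ X :* X :* ((1# :- q :* X :* V) :* C)
                 := :- (X :* u :* V) :* (1# :- q :* (X :* Y)) :* ((1# :- q :* X :* V) :* C)
                      :- X :* X :* (V :* V) :* (1# :- Y :* Y) :* C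
                   :+ (:- (X :* X :* V :* V :* (1# :- q :* X :* Y) :* C)) :* (q :* u :- 1#)
                   :+ (q :* X :* X :* X :* V :- X :* X :* (Y :* V :+ 1#)) :* C :* (Y :* V :- 1#))
               refl q u X Y V C) qu≈1 (^-inverse qu≈1 i) ⟩
        - (X * u * V) * (1# - q * (X * Y)) * ((1# - q * X * V) * C) - G i
          ≈⟨ +-congʳ (*-congˡ (α-core n i)) ⟨
        - (X * u * V) * (1# - q * (X * Y)) * α n i - G i
          -- The first term is already the certificate at i + 1: `core n (suc i)` contains
          -- 1/(q;q)ₙ₋ᵢ, the same reciprocal factorial as α n i.
          ≈⟨ +-congʳ (mod₃ (solve 10 (λ q u X U Y V e z s k → let 1# = con (+ 1) in
               :- (X :* u :* V) :* (1# :- q :* (X :* Y)) :* (e :* z :* s :* k)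
                 := X :* X :* (u :* V :* (u :* V))
                      :* (:- (q :* Y :* U :* e) :* (z :* (1# :- q :* (X :* Y))) :* s :* k)
                   :+ X :* u :* V :* (1# :- q :* (X :* Y)) :* (e :* z :* s :* k) :* (q :* u :* (Y :* V))
                        :* (X :* U :- 1#)
                   :+ X :* u :* V :* (1# :- q :* (X :* Y)) :* (e :* z :* s :* k) :* (Y :* V) :* (q :* u :- 1#)
                   :+ X :* u :* V :* (1# :- q :* (X :* Y)) :* (e :* z :* s :* k) :* (Y :* V :- 1#))
               refl q u X (u ^ n) Y V (E.weight n i) (poch q q (n ℕ.+ i)) Q.1/[ n ∸ i ]! P.1/[ i ]!)
               (^-inverse qu≈1 n) qu≈1 (^-inverse qu≈1 i)) ⟩
        X * X * (u * V * (u * V))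
          * (- (q * Y * u ^ n * E.weight n i) * (poch q q (n ℕ.+ i) * (1# - q * (X * Y)))
               * Q.1/[ n ∸ i ]! * P.1/[ i ]!) - G i
          ≈⟨ +-congʳ (*-congˡ (*-cong (*-congʳ (*-cong (E.weight-sucʳ n i) poch-suc)) 1/!)) ⟨
        X * X * (u * V * (u * V))
          * (E.weight n (suc i) * poch q q (n ℕ.+ suc i)
               * Q.1/[ n ∸ i ]! * ((1# - q * Y * (q * Y)) * P.1/[ suc i ]!)) - G i
          ≈⟨ +-congʳ (solve 6 (λ x e z s y k →
               x :* (e :* z :* s :* (y :* k)) := x :* y :* (e :* z :* s :* k)) refl _ _ _ _ _ _) ⟩
        G (suc i) - G i
          ∎
        where
        X = q ^ n
        Y = q ^ i
        V = u ^ i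
        C = core n i
        G = certificate n

        poch-suc : poch q q (n ℕ.+ suc i) ≈ poch q q (n ℕ.+ i) * (1# - q * (X * Y))
        poch-suc = trans (reflexive (≡.cong (poch q q) (ℕ.+-suc n i)))
          (*-congˡ (+-congˡ (-‿cong (*-congˡ (^-homo-* q n i)))))

        1/! : (1# - q * Y * (q * Y)) * P.1/[ suc i ]! ≈ P.1/[ i ]!
        1/! = sym (trans (P.1/!-suc i) (*-congʳ (+-congˡ (-‿cong (square-^ q (suc i))))))

    -- The sum is the value of the expansion at b = 0: there the prefactor of Uₙ tends to q^(n²-n),
    -- and its bracket to 1 + 2 ∑ⱼ (-1)ʲ = (-1)ⁿ.
    ∑-α : ∀ n M → n ℕ.< M → ∑ M (α n) ≈ σ n
    ∑-α zero (suc M) _ = begin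
      1# * 1# * Q.1/[ 0 ]! * P.1/[ 0 ]! + ∑ M (λ i → α 0 (suc i))
        ≈⟨ +-cong (*-cong (*-congˡ Q.1/!-0) P.1/!-0)
             (∑-zero M {λ i → α 0 (suc i)} λ i _ → α-> (s≤s z≤n)) ⟩
      1# * 1# * 1# * 1# + 0#
        ≈⟨ solve 0 (con (+ 1) :* con (+ 1) :* con (+ 1) :* con (+ 1) :+ con (+ 0) := con (+ 1)) refl ⟩
      1# ∎
    ∑-α (suc n) M 1+n<M = begin
      ∑ M (α (suc n))
        ≈⟨ solve 3 (λ a b x → a := a :+ x :* b :- x :* b) refl (∑ M (α (suc n))) (∑ M (α n)) (X * X) ⟩
      ∑ M (α (suc n)) + X * X * ∑ M (α n) - X * X * ∑ M (α n)
        ≈⟨ +-cong zero-sum (-‿cong (*-congˡ (∑-α n M (ℕ.<-trans (ℕ.n<1+n n) 1+n<M)))) ⟩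
      0# - X * X * σ n
        ≈⟨ +-identityˡ _ ⟩
      σ (suc n) ∎
      where
      X = q ^ n
      G = certificate n

      zero-sum : ∑ M (α (suc n)) + X * X * ∑ M (α n) ≈ 0#
      zero-sum = begin
        ∑ M (α (suc n)) + X * X * ∑ M (α n)            ≈⟨ +-congˡ (∑-*ˡ M (X * X) (α n)) ⟩
        ∑ M (α (suc n)) + ∑ M (λ i → X * X * α n i)    ≈⟨ ∑-+ M (α (suc n)) (λ i → X * X * α n i) ⟨
        ∑ M (λ i → α (suc n) i + X * X * α n i)        ≈⟨ ∑-telescope M G (α-telescope n) ⟩
        G M - G 0                                      ≈⟨ +-cong GM≈0 (-‿cong G0≈0) ⟩
        0# - 0#                                        ≈⟨ -‿inverseʳ 0# ⟩
        0#                                             ∎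
        where
        GM≈0 : G M ≈ 0#
        GM≈0 = annihilateʳ (annihilateˡ (annihilateʳ (reflexive (Q.1/∸!-> 1+n<M))))

        G0≈0 : G 0 ≈ 0#
        G0≈0 = annihilateˡ (annihilateʳ (trans (+-congˡ (-‿cong (*-identityˡ 1#))) (-‿inverseʳ 1#)))

  -- The Bailey sum at a single pole, by q-Zeilberger telescoping

  module BaileySum {q : Carrier} (base : IsBase q) where
    open Coefficients base

    -- The coefficient of 1/(1 - b² q²ⁱ) in the j-th Bailey term. The 1/(1 - q²) that Uⱼ carries has
    -- been merged with 1/(q⁴;q²)ₙ₊ⱼ into 1/(q²;q²)ₙ₊ⱼ₊₁.
    summand : ℕ → ℕ → ℕ → Carrier
    summand i n j = (1# - q * q * (q ^ j * q ^ j * (q ^ j * q ^ j))) * α j i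
                    * P.1/[ n ∸ j ]! * P.1/[ suc (n ℕ.+ j) ]!

    module _ (i n : ℕ) where
      private
        a X : Carrier
        a = q ^ i
        X = q ^ n

        -- A common factor of the summands at n and n + 1 and of the certificate at j and j + 1. The
        -- powers of u are chosen so that all four cofactors are polynomials in q, qⁱ, qⁿ and qʲ.
        core : ℕ → Carrier
        core j = u * u * u ^ j * α j i * (u ^ j * u ^ j * P.1/[ suc n ∸ j ]!)
                 * P.1/[ suc (suc (n ℕ.+ j)) ]!

        -- The polynomial part, in Y = qʲ, of the q-Zeilberger certificate.
        certificate-factor : Carrier → Carrier
        certificate-factor Y = q * q * (X * X) + (q * q * (X * X) + q) * a * Y
          + ((q - 1#) + q * q * (1# + q) * (X * X)) * (Y * Y)
          + (q * q * (X * X) + q) * a * (Y * Y * Y) + q * q * (X * X) * (Y * Y * (Y * Y))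

        -- The factor a - qʲ is the one that multiplies α j i on the left of `α-suc`, so the
        -- certificate at j + 1 can be expressed through α j i even when j + 1 = i.
        certificate : ℕ → Carrier
        certificate j = certificate-factor (q ^ j) * (a - q ^ j) * u ^ j * α j i
                        * P.1/[ suc n ∸ j ]! * P.1/[ suc (n ℕ.+ j) ]!

        module _ (j : ℕ) where
          Y V C : Carrier
          Y = q ^ j
          V = u ^ j
          C = core j

          1/!-core : P.1/[ suc (n ℕ.+ j) ]!
            ≈ (1# - q * q * (X * Y) * (q * q * (X * Y))) * P.1/[ suc (suc (n ℕ.+ j)) ]!
          1/!-core = trans (P.1/!-suc (suc (n ℕ.+ j))) (*-congʳ (+-congˡ (-‿cong
            (trans (square-^ q (suc (suc (n ℕ.+ j)))) (*-cong q^ q^)))))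
            where
            q^ : q * (q * q ^ (n ℕ.+ j)) ≈ q * q * (X * Y)
            q^ = trans (sym (*-assoc _ _ _)) (*-congˡ (^-homo-* q n j))

          1/∸!-core : P.1/[ n ∸ j ]! ≈ (1# - q * X * (q * X) * (V * V)) * P.1/[ suc n ∸ j ]!
          1/∸!-core = trans (P.1/∸!-suc n j) (*-congʳ (+-congˡ (-‿cong
            (*-cong (square-^ q (suc n)) (square-^ u j)))))

          YV : Y * V ≈ 1#
          YV = ^-inverse qu≈1 j

          summand-suc-core : summand i (suc n) j
            ≈ (1# - q * q * (Y * Y * (Y * Y))) * (q * q * Y) * (Y * Y) * C
          summand-suc-core = sym (mod₂ (solve 8 (λ q u Y V y α r k → let 1# = con (+ 1) in
              y :* (q :* q :* Y) :* (Y :* Y) :* (u :* u :* V :* α :* (V :* V :* r) :* k)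
                := y :* α :* r :* k
                  :+ y :* α :* r :* k :* (Y :* V :* (Y :* V) :* (Y :* V)) :* (q :* u :+ 1#) :* (q :* u :- 1#)
                  :+ y :* α :* r :* k :* (Y :* V :* (Y :* V) :+ Y :* V :+ 1#) :* (Y :* V :- 1#))
            refl q u Y V (1# - q * q * (Y * Y * (Y * Y))) (α j i)
              P.1/[ suc n ∸ j ]! P.1/[ suc (suc (n ℕ.+ j)) ]!)
            qu≈1 YV)

          summand-core : summand i n j
            ≈ (1# - q * q * (Y * Y * (Y * Y))) * (q * q * Y) * (Y * Y - q * X * (q * X))
              * (1# - q * q * (X * Y) * (q * q * (X * Y))) * C
          summand-core = trans (*-cong (*-congˡ 1/∸!-core) 1/!-core) (sym
            (mod₂ (solve 10 (λ q u Y V Z y w α r k → let 1# = con (+ 1) in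
                y :* (q :* q :* Y) :* (Y :* Y :- Z) :* w :* (u :* u :* V :* α :* (V :* V :* r) :* k)
                  := y :* α :* ((1# :- Z :* (V :* V)) :* r) :* (w :* k)
                    :+ y :* w :* α :* r :* k :* (Y :* V) :* V :* V :* (Y :* Y :- Z) :* (q :* u :+ 1#)
                         :* (q :* u :- 1#)
                    :+ y :* w :* α :* r :* k :* (V :* V :* (Y :* Y :- Z) :+ (Y :* V :+ 1#))
                         :* (Y :* V :- 1#))
              refl q u Y V (q * X * (q * X)) (1# - q * q * (Y * Y * (Y * Y)))
                (1# - q * q * (X * Y) * (q * q * (X * Y))) (α j i)
                P.1/[ suc n ∸ j ]! P.1/[ suc (suc (n ℕ.+ j)) ]!)
              qu≈1 YV))

          certificate-core : certificate j
            ≈ q * q * (certificate-factor Y * (a - Y)) * (Y * Y)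
              * (1# - q * q * (X * Y) * (q * q * (X * Y))) * C
          certificate-core = trans (*-congˡ 1/!-core) (sym
            (mod₂ (solve 9 (λ q u Y V f w α r k → let 1# = con (+ 1) in
                q :* q :* f :* (Y :* Y) :* w :* (u :* u :* V :* α :* (V :* V :* r) :* k)
                  := f :* V :* α :* r :* (w :* k)
                    :+ f :* V :* α :* r :* w :* k :* (Y :* V :* (Y :* V)) :* (q :* u :+ 1#)
                         :* (q :* u :- 1#)
                    :+ f :* V :* α :* r :* w :* k :* (Y :* V :+ 1#) :* (Y :* V :- 1#))
              refl q u Y V (certificate-factor Y * (a - Y)) (1# - q * q * (X * Y) * (q * q * (X * Y)))
                (α j i) P.1/[ suc n ∸ j ]! P.1/[ suc (suc (n ℕ.+ j)) ]!)
              qu≈1 YV))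

          certificate-suc-core : certificate (suc j)
            ≈ certificate-factor (q * Y) * (Y * (q * a * Y - 1#)) * (Y * Y - q * X * (q * X)) * C
          certificate-suc-core = begin
            f * (a - q * Y) * (u * V) * α (suc j) i * P.1/[ n ∸ j ]! * P.1/[ suc (n ℕ.+ suc j) ]!
              ≈⟨ solve 6 (λ f y v α r k → f :* y :* v :* α :* r :* k := f :* v :* (y :* α) :* r :* k)
                   refl f (a - q * Y) (u * V) (α (suc j) i) P.1/[ n ∸ j ]! P.1/[ suc (n ℕ.+ suc j) ]! ⟩
            f * (u * V) * ((a - q * Y) * α (suc j) i) * P.1/[ n ∸ j ]! * P.1/[ suc (n ℕ.+ suc j) ]!
              ≈⟨ *-cong (*-cong (*-congˡ (α-suc j i)) 1/∸!-core)
                   (reflexive (≡.cong (λ m → P.1/[ suc m ]!) (ℕ.+-suc n j))) ⟩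
            f * (u * V) * (α j i * (Y * Y * a - Y * u)) * ((1# - Z * (V * V)) * r) * k
              ≈⟨ mod₂ (solve 10 (λ q u a Y V Z f α r k → let 1# = con (+ 1) in
                   f :* (Y :* (q :* a :* Y :- 1#)) :* (Y :* Y :- Z)
                       :* (u :* u :* V :* α :* (V :* V :* r) :* k)
                     := f :* (u :* V) :* (α :* (Y :* Y :* a :- Y :* u))
                            :* ((1# :- Z :* (V :* V)) :* r) :* k
                       :+ f :* α :* r :* k :* Y :* V :* u :* a :* Y :* (Y :* Y :- Z) :* V :* V
                            :* (q :* u :- 1#)
                       :+ f :* α :* r :* k :* Y :* V :* u :* (Y :* a :- u) :* (Y :* V :+ 1#)
                            :* (Y :* V :- 1#))
                   refl q u a Y V Z f (α j i) r k) qu≈1 YV ⟨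
            f * (Y * (q * a * Y - 1#)) * (Y * Y - Z) * C
              ∎
            where
            f = certificate-factor (q * Y)
            Z = q * X * (q * X)
            r = P.1/[ suc n ∸ j ]!
            k = P.1/[ suc (suc (n ℕ.+ j)) ]!

          summand-telescope :
            (- (a * a - q * X * (q * X)) * ((1# + q * (X * X)) * (1# + q * q * (X * X))) * q)
                * summand i (suc n) j
              + (- (X * X)) * summand i n j
            ≈ certificate (suc j) - certificate j
          summand-telescope = trans (+-cong (*-congˡ summand-suc-core) (*-congˡ summand-core)) (trans
            -- With `core` factored out, the telescoping relation is an identity of polynomials; the
            -- relation q u = 1 no longer enters.
            (solve 5 (λ q a X Y C →
              let 1# = con (+ 1)
                  factor = λ Y → q :* q :* (X :* X) :+ (q :* q :* (X :* X) :+ q) :* a :* Y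
                    :+ ((q :- 1#) :+ q :* q :* (1# :+ q) :* (X :* X)) :* (Y :* Y)
                    :+ (q :* q :* (X :* X) :+ q) :* a :* (Y :* Y :* Y)
                    :+ q :* q :* (X :* X) :* (Y :* Y :* (Y :* Y))
                  Z = q :* X :* (q :* X)
                  y = 1# :- q :* q :* (Y :* Y :* (Y :* Y))
                  w = 1# :- q :* q :* (X :* Y) :* (q :* q :* (X :* Y))
              in (:- (a :* a :- Z) :* ((1# :+ q :* (X :* X)) :* (1# :+ q :* q :* (X :* X))) :* q)
                     :* (y :* (q :* q :* Y) :* (Y :* Y) :* C)
                   :+ (:- (X :* X)) :* (y :* (q :* q :* Y) :* (Y :* Y :- Z) :* w :* C)
                 := factor (q :* Y) :* (Y :* (q :* a :* Y :- 1#)) :* (Y :* Y :- Z) :* C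
                   :- q :* q :* (factor Y :* (a :- Y)) :* (Y :* Y) :* w :* C)
              refl q a X Y C)
            (sym (+-cong certificate-suc-core (-‿cong certificate-core))))

        -- The factor qⁱ - 1 vanishes for i = 0, and α 0 i vanishes for i > 0.
        certificate-0 : certificate 0 ≈ 0#
        certificate-0 = trans (*-congʳ (*-congʳ (trans
          (solve 4 (λ f y v α → f :* y :* v :* α := f :* v :* (y :* α)) refl _ _ _ _)
          (annihilateʳ (vanish i))))) (annihilateˡ (zeroˡ _))
          where
          vanish : ∀ i → (q ^ i - 1#) * α 0 i ≈ 0#
          vanish zero    = annihilateˡ (-‿inverseʳ 1#)
          vanish (suc i) = annihilateʳ (α-> (s≤s z≤n))

        certificate-end : certificate (suc (suc n)) ≈ 0#
        certificate-end = annihilateˡ (annihilateʳ (reflexive (P.1/∸!-> (ℕ.n<1+n (suc n)))))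

      -- The factors 1 + q²ⁿ⁺¹ and 1 + q²ⁿ⁺² are those that (-q;q)₂ₙ gains in passing to n + 1. Once
      -- they are absorbed, the recurrence is that of `F.residue`. The range for n extends to n + 1
      -- because the added summand is 0.
      ∑-summand-suc :
        (a * a - q * X * (q * X)) * ((1# + q * (X * X)) * (1# + q * q * (X * X))) * q
            * ∑ (suc (suc n)) (summand i (suc n))
          ≈ - (X * X) * ∑ (suc n) (summand i n)
      ∑-summand-suc = mod₂ (solve 5 (λ d x S₁ S s →
          d :* S₁ := (:- x) :* S
            :+ (:- con (+ 1)) :* ((:- d) :* S₁ :+ (:- x) :* (S :+ s) :- con (+ 0))
            :+ (:- x) :* (s :- con (+ 0)))
        refl (d * w * q) (X * X) (∑ M (summand i (suc n))) (∑ (suc n) (summand i n)) (summand i n (suc n)))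
        (begin
          - (d * w * q) * ∑ M (summand i (suc n))
              + - (X * X) * (∑ (suc n) (summand i n) + summand i n (suc n))
            ≈⟨ +-cong (*-congʳ (solve 3 (λ d w q → :- (d :* w :* q) := (:- d) :* w :* q) refl d w q))
                 (*-congˡ (sym (∑-last (suc n) (summand i n)))) ⟩
          - d * w * q * ∑ M (summand i (suc n)) + - (X * X) * ∑ M (summand i n)
            ≈⟨ ∑-linear M _ _ (summand i (suc n)) (summand i n) ⟨
          ∑ M (λ j → - d * w * q * summand i (suc n) j + - (X * X) * summand i n j)
            ≈⟨ ∑-telescope M certificate summand-telescope ⟩
          certificate M - certificate 0
            ≈⟨ +-cong certificate-end (-‿cong certificate-0) ⟩
          0# - 0#
            ≈⟨ -‿inverseʳ 0# ⟩
          0# ∎)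
        (annihilateˡ (annihilateʳ (reflexive (P.1/∸!-> (ℕ.n<1+n n)))))
        where
        M = suc (suc n)
        d = a * a - q * X * (q * X)
        w = (1# + q * (X * X)) * (1# + q * q * (X * X))

    poch-q² : ∀ m → poch q q m * poch (- q) q m ≈ poch q² q² m
    poch-q² zero    = *-identityˡ 1#
    poch-q² (suc m) = begin
      poch q q m * (1# - q * X) * (poch (- q) q m * (1# - - q * X))
        ≈⟨ solve 4 (λ z w q X → let 1# = con (+ 1) in
             z :* (1# :- q :* X) :* (w :* (1# :- :- q :* X))
               := z :* w :* (1# :- q :* (q :* 1#) :* (X :* X)))
           refl (poch q q m) (poch (- q) q m) q X ⟩
      poch q q m * poch (- q) q m * (1# - q² * (X * X))
        ≈⟨ *-cong (poch-q² m) (+-congˡ (-‿cong (*-congˡ (sym (square-^ q m))))) ⟩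
      poch q² q² (suc m) ∎
      where
      X = q ^ m

    poch-−q-even : ∀ n → poch (- q) q (2 ℕ.* suc n)
      ≈ poch (- q) q (2 ℕ.* n) * ((1# + q * (q ^ n * q ^ n)) * (1# + q * q * (q ^ n * q ^ n)))
    poch-−q-even n = begin
      poch (- q) q (2 ℕ.* suc n)
        ≡⟨ ≡.cong (poch (- q) q) (ℕ.*-suc 2 n) ⟩
      poch (- q) q (2 ℕ.* n) * (1# - - q * q ^ (2 ℕ.* n)) * (1# - - q * (q * q ^ (2 ℕ.* n)))
        ≈⟨ *-cong (*-congˡ (+-congˡ (-‿cong (*-congˡ q^2n)))) (+-congˡ (-‿cong (*-congˡ (*-congˡ q^2n)))) ⟩
      poch (- q) q (2 ℕ.* n) * (1# - - q * (X * X)) * (1# - - q * (q * (X * X)))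
        ≈⟨ solve 3 (λ z q X → let 1# = con (+ 1) in
             z :* (1# :- :- q :* (X :* X)) :* (1# :- :- q :* (q :* (X :* X)))
               := z :* ((1# :+ q :* (X :* X)) :* (1# :+ q :* q :* (X :* X))))
             refl (poch (- q) q (2 ℕ.* n)) q X ⟩
      poch (- q) q (2 ℕ.* n) * ((1# + q * (X * X)) * (1# + q * q * (X * X)))
        ∎
      where
      X = q ^ n
      q^2n : q ^ (2 ℕ.* n) ≈ X * X
      q^2n = trans (sym (^-assocʳ q 2 n)) (square-^ q n)

    -- The induction starts at n = i, since the leading factor q²ⁱ - q²ⁿ⁺² of the recurrence
    -- vanishes at n + 1 = i and is apart from 0 from n = i on. At n = i only the term j = i
    -- survives, as α j i = 0 for j < i.
    ∑-summand : ∀ i N → let n = N ℕ.+ i in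
      poch (- q) q (2 ℕ.* n) * ∑ (suc n) (summand i n) ≈ F.residue n i
    ∑-summand i zero = begin
      poch (- q) q (2 ℕ.* i) * ∑ (suc i) (summand i i)
        ≈⟨ *-congˡ (∑-last i (summand i i)) ⟩
      poch (- q) q (2 ℕ.* i) * (∑ i (summand i i) + summand i i i)
        ≈⟨ *-congˡ (trans (+-congʳ (∑-zero i {summand i i} λ j j<i → below j<i)) (+-identityˡ _)) ⟩
      poch (- q) q (2 ℕ.* i)
        * (y * (E.weight i i * poch q q (i ℕ.+ i) * Q.1/[ i ∸ i ]! * P.1/[ i ]!) * P.1/[ i ∸ i ]! * k)
        ≈⟨ *-cong (reflexive (≡.cong (poch (- q) q) 2*i))
             (*-congʳ (*-congʳ (*-congˡ (*-congʳ (*-cong (*-congʳ weights) Q-diagonal))))) ⟩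
      poch (- q) q (i ℕ.+ i)
        * (y * (F.weight i i * poch q q (i ℕ.+ i) * 1# * P.1/[ i ]!) * P.1/[ i ∸ i ]! * k)
        ≈⟨ solve 7 (λ z w f x r y k →
               z :* (y :* (f :* w :* con (+ 1) :* x) :* r :* k) := f :* r :* x :* (w :* z :* (y :* k)))
             refl (poch (- q) q (i ℕ.+ i)) (poch q q (i ℕ.+ i)) (F.weight i i)
             P.1/[ i ]! P.1/[ i ∸ i ]! y k ⟩
      -- The (q;q)₂ᵢ of α combines with (-q;q)₂ᵢ to (q²;q²)₂ᵢ, while y = 1 - (q²)²ⁱ⁺¹ lowers
      -- 1/(q²;q²)₂ᵢ₊₁ to its reciprocal.
      F.residue i i * (poch q q (i ℕ.+ i) * poch (- q) q (i ℕ.+ i) * (y * k))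
        ≈⟨ *-congˡ (*-cong (poch-q² (i ℕ.+ i)) (sym yk)) ⟩
      F.residue i i * (poch q² q² (i ℕ.+ i) * P.1/[ i ℕ.+ i ]!)
        ≈⟨ *-congˡ (inverseʳ _ _) ⟩
      F.residue i i * 1#
        ≈⟨ *-identityʳ _ ⟩
      F.residue i i ∎
      where
      y = 1# - q * q * (q ^ i * q ^ i * (q ^ i * q ^ i))
      k = P.1/[ suc (i ℕ.+ i) ]!

      2*i : 2 ℕ.* i ≡ i ℕ.+ i
      2*i = ≡.cong (i ℕ.+_) (ℕ.+-identityʳ i)

      below : ∀ {j} → j ℕ.< i → summand i i j ≈ 0#
      below j<i = annihilateˡ (annihilateˡ (annihilateʳ (α-> j<i)))

      weights : E.weight i i ≈ F.weight i i
      weights = trans (E.weight-diagonal i) (sym (F.weight-diagonal i))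

      Q-diagonal : Q.1/[ i ∸ i ]! ≈ 1#
      Q-diagonal = trans
        (reflexive (≡.trans (Q.1/∸!-∸ (ℕ.≤-refl {i})) (≡.cong Q.1/[_]! (ℕ.n∸n≡0 i)))) Q.1/!-0

      yk : P.1/[ i ℕ.+ i ]! ≈ y * k
      yk = trans (P.1/!-suc (i ℕ.+ i)) (*-congʳ (+-congˡ (-‿cong (begin
        q² * q² ^ (i ℕ.+ i)                       ≈⟨ *-cong (*-congˡ (*-identityʳ q)) (square-^ q (i ℕ.+ i)) ⟩
        q * q * (q ^ (i ℕ.+ i) * q ^ (i ℕ.+ i))   ≈⟨ *-congˡ (*-cong (^-homo-* q i i) (^-homo-* q i i)) ⟩
        q * q * (q ^ i * q ^ i * (q ^ i * q ^ i)) ∎))))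
    ∑-summand i (suc N) = *-cancelˡ-# nonzero (begin
      (q² ^ i - q² * q² ^ n) * (poch (- q) q (2 ℕ.* suc n) * ∑ (suc (suc n)) (summand i (suc n)))
        ≈⟨ *-cong (+-cong (square-^ q i) (-‿cong (square-^ q (suc n)))) (*-congʳ (poch-−q-even n)) ⟩
      (a * a - q * X * (q * X)) * (z * ((1# + q * (X * X)) * (1# + q * q * (X * X))) * S₁)
        ≈⟨ mod₂ (solve 8 (λ q u d w z X S₁ S → let 1# = con (+ 1) in
             d :* (z :* w :* S₁) := :- (X :* X :* u :* (z :* S))
               :+ z :* u :* (d :* w :* q :* S₁ :- :- (X :* X) :* S)
               :+ (:- (z :* d :* w :* S₁)) :* (q :* u :- 1#))
             refl q u (a * a - q * X * (q * X)) ((1# + q * (X * X)) * (1# + q * q * (X * X))) z X S₁ S)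
             (∑-summand-suc i n) qu≈1 ⟩
      - (X * X * u * (z * S))
        ≈⟨ -‿cong (*-cong (*-congʳ (sym (square-^ q n))) (∑-summand i N)) ⟩
      - (q² ^ n * u * F.residue n i)
        ≈⟨ F.residue-suc n i ⟨
      F.residue (suc n) i * (q² ^ i - q² * q² ^ n)
        ≈⟨ *-comm _ _ ⟩
      (q² ^ i - q² * q² ^ n) * F.residue (suc n) i ∎)
      where
      n = N ℕ.+ i
      a = q ^ i
      X = q ^ n
      z = poch (- q) q (2 ℕ.* n)
      S = ∑ (suc n) (summand i n)
      S₁ = ∑ (suc (suc n)) (summand i (suc n))

      nonzero : q² ^ i - q² * q² ^ n # 0#
      nonzero = #-congʳ (begin
        q² ^ i * (1# - q² * q² ^ N)          ≈⟨ solve 3 (λ P p Q →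
                                                  P :* (con (+ 1) :- p :* Q) := P :- p :* (Q :* P))
                                                  refl (q² ^ i) q² (q² ^ N) ⟩
        q² ^ i - q² * (q² ^ N * q² ^ i)      ≈⟨ +-congˡ (-‿cong (*-congˡ (^-homo-* q² N i))) ⟨
        q² ^ i - q² * q² ^ n                 ∎)
        (*#0 (^#0 (^#0 q#0 2) i) (#0-factorʳ ([q²]ₙ#0 base (suc N))))

  -- The partial fraction expansion of Uₙ in b

  module UExpansion {q : Carrier} (base : IsBase q)
                    {b : Carrier} (b#0 : b # 0#) (den : UDenominators q b b#0) where
    open Coefficients base
    open UDenominators den

    private
      b⁻¹ q/b : Carrier
      b⁻¹ = inverse b b#0
      q/b = q / b ⟨ b#0 ⟩

      bb⁻¹≈1 : b * b⁻¹ ≈ 1#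
      bb⁻¹≈1 = inverseʳ b b#0

    1-bqⁱ#0 : ∀ i → 1# - b * q ^ i # 0#
    1-bqⁱ#0 zero    = #-congʳ (+-congˡ (-‿cong (sym (*-identityʳ b)))) 1-b#0
    1-bqⁱ#0 (suc i) = #-congʳ (+-congˡ (-‿cong (*-assoc b q (q ^ i)))) (#0-factorʳ ([bq]ₙ#0 (suc i)))

    κ : ℕ → Carrier
    κ i = inverse (1# - b * q ^ i) (1-bqⁱ#0 i)

    private
      fractions : ℕ → ℕ → Carrier
      fractions M n = ∑ M λ i → α n i * κ i

      -- Split 1 - b qⁿ⁺¹ = (1 - b qⁱ) + b (qⁱ - qⁿ⁺¹), and treat the factor on the right likewise.
      -- By `α-suc` the parts that keep `κ i` cancel, which leaves ∑ α (n+1) i - q²ⁿ ∑ α n i, a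
      -- quantity free of b.
      fractions-suc : ∀ n M → suc n ℕ.< M → let X = q ^ n in
        (1# - b * q ^ suc n) * fractions M (suc n)
          ≈ (X * X - b * u * X) * fractions M n + (1# + 1#) * σ (suc n)
      fractions-suc n M 1+n<M = mod₁ (solve 5 (λ x f′ y f s → let 2# = con (+ 1) :+ con (+ 1) in
          x :* f′ := y :* f :+ 2# :* s :+ con (+ 1) :* (x :* f′ :+ (:- y) :* f :- 2# :* s))
        refl (1# - b * q ^ suc n) (fractions M (suc n)) (X * X - b * u * X) (fractions M n) (σ (suc n)))
        (begin
          (1# - b * q ^ suc n) * fractions M (suc n) + - (X * X - b * u * X) * fractions M n
            ≈⟨ ∑-linear M _ _ (λ i → α (suc n) i * κ i) (λ i → α n i * κ i) ⟨
          ∑ M (λ i → (1# - b * q ^ suc n) * (α (suc n) i * κ i) + - (X * X - b * u * X) * (α n i * κ i))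
            ≈⟨ ∑-cong M (λ i _ → step i) ⟩
          ∑ M (λ i → 1# * α (suc n) i + - (X * X) * α n i)
            ≈⟨ ∑-linear M 1# (- (X * X)) (α (suc n)) (α n) ⟩
          1# * ∑ M (α (suc n)) + - (X * X) * ∑ M (α n)
            ≈⟨ +-cong (*-congˡ (∑-α (suc n) M 1+n<M))
                 (*-congˡ (∑-α n M (ℕ.<-trans (ℕ.n<1+n n) 1+n<M))) ⟩
          -- Because σ changes sign at each step, the two sums add up instead of cancelling; this
          -- produces the constant 2.
          1# * - (X * X * σ n) + - (X * X) * σ n
            ≈⟨ solve 2 (λ X s → let 1# = con (+ 1) in 1# :* :- (X :* X :* s) :+ (:- (X :* X)) :* s
                 := (1# :+ 1#) :* :- (X :* X :* s)) refl X (σ n) ⟩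
          (1# + 1#) * σ (suc n) ∎)
        where
        X = q ^ n
        step : ∀ i → (1# - b * q ^ suc n) * (α (suc n) i * κ i) + - (X * X - b * u * X) * (α n i * κ i)
                     ≈ 1# * α (suc n) i + - (X * X) * α n i
        step i = mod₂ (solve 8 (λ q u b X Y κ α α′ → let 1# = con (+ 1) in
            (1# :- b :* (q :* X)) :* (α′ :* κ) :+ (:- (X :* X :- b :* u :* X)) :* (α :* κ)
              := 1# :* α′ :+ (:- (X :* X)) :* α
                :+ κ :* b :* ((Y :- q :* X) :* α′ :- α :* (X :* X :* Y :- X :* u))
                :+ (α′ :- X :* X :* α) :* ((1# :- b :* Y) :* κ :- 1#))
          refl q u b X (q ^ i) (κ i) (α n i) (α (suc n) i)) (α-suc n i) (inverseʳ _ (1-bqⁱ#0 i))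

      prefactor#0 : ∀ n → q ^ n * (1# - b) * poch (b * q) q n # 0#
      prefactor#0 n = *#0 (*#0 (^#0 q#0 n) 1-b#0) ([bq]ₙ#0 n)

      w : ℕ → Carrier
      w n = inverse (q ^ n * (1# - b) * poch (b * q) q n) (prefactor#0 n)

      w-suc : ∀ n → (1# - b * q ^ suc n) * w (suc n) ≈ u * w n
      w-suc n = mod₂
        (solve 5 (λ q u y w′ w → let 1# = con (+ 1) in
           y :* w′ := u :* w :+ u :* (q :* y :* w′ :- w) :+ (:- (y :* w′)) :* (q :* u :- 1#))
         refl q u (1# - b * q ^ suc n) (w (suc n)) (w n))
        (inverse-unique (begin
          q ^ n * (1# - b) * poch (b * q) q n * (q * (1# - b * q ^ suc n) * w (suc n))
            ≈⟨ solve 6 (λ q X b y z w → let 1# = con (+ 1) in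
                 X :* y :* z :* (q :* (1# :- b :* (q :* X)) :* w)
                   := q :* X :* y :* (z :* (1# :- b :* q :* X)) :* w)
                 refl q (q ^ n) b (1# - b) (poch (b * q) q n) (w (suc n)) ⟩
          q ^ suc n * (1# - b) * poch (b * q) q (suc n) * w (suc n)
            ≈⟨ inverseʳ _ (prefactor#0 (suc n)) ⟩
          1# ∎) (inverseʳ _ (prefactor#0 n)))
        qu≈1

      q^triangular-suc : ∀ n → q ^ triangular (suc n) ≈ q ^ triangular n * q ^ n
      q^triangular-suc n = trans (^-congʳ q (triangular-suc n)) (^-homo-* q (triangular n) n)

      prefactor : ℕ → Carrier
      prefactor n = poch q/b q n * (- b) ^ n * q ^ triangular n * w n

      prefactor-suc : ∀ n → let X = q ^ n in
        (1# - b * q ^ suc n) * prefactor (suc n) ≈ (X * X - b * u * X) * prefactor n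
      prefactor-suc n = begin
        y * (z * (1# - q/b * X) * (- b * B) * q ^ triangular (suc n) * w (suc n))
          ≈⟨ *-congˡ (*-congʳ (*-congˡ (q^triangular-suc n))) ⟩
        y * (z * (1# - q/b * X) * (- b * B) * (t * X) * w (suc n))
          ≈⟨ solve 8 (λ y z x b B t X w → y :* (z :* x :* (:- b :* B) :* (t :* X) :* w)
               := z :* x :* (:- b :* B) :* (t :* X) :* (y :* w))
               refl y z (1# - q/b * X) b B t X (w (suc n)) ⟩
        z * (1# - q/b * X) * (- b * B) * (t * X) * (y * w (suc n))
          ≈⟨ *-congˡ (w-suc n) ⟩
        z * (1# - q/b * X) * (- b * B) * (t * X) * (u * w n)
          ≈⟨ mod₂ (solve 9 (λ q u b b⁻¹ X z B t w → let 1# = con (+ 1) in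
               z :* (1# :- q :* b⁻¹ :* X) :* (:- b :* B) :* (t :* X) :* (u :* w)
                 := (X :* X :- b :* u :* X) :* (z :* B :* t :* w)
                   :+ X :* X :* z :* B :* t :* w :* (b :* b⁻¹) :* (q :* u :- 1#)
                   :+ X :* X :* z :* B :* t :* w :* (b :* b⁻¹ :- 1#))
               refl q u b b⁻¹ X z B t (w n)) qu≈1 bb⁻¹≈1 ⟩
        (X * X - b * u * X) * (z * B * t * w n) ∎
        where
        X = q ^ n
        y = 1# - b * q ^ suc n
        z = poch q/b q n
        B = (- b) ^ n
        t = q ^ triangular n

      term : ℕ → Carrier
      term j = poch b q j / poch q/b q j ⟨ [q/b]ₙ#0 j ⟩ * b⁻¹ ^ j * q ^ (j ℕ.* (j ℕ.+ 1) ℕ./ 2)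

      -- (b;q)ₙ (1 - b qⁿ) = (1 - b) (bq;q)ₙ cancels the denominator, (q/b;q)ₙ and the powers of b
      -- cancel up to (-1)ⁿ, and the exponents of q add up to n(n-1)/2 + n(n+1)/2 - n = n² - n. So a
      -- new term of the inner sum enters the recurrence free of b.
      prefactor-term : ∀ n → (1# - b * q ^ n) * (prefactor n * term n) ≈ σ n
      prefactor-term n = begin
        (1# - b * X) * (z * B * t * w n * (p * z⁻¹ * B⁻¹ * q ^ (n ℕ.* (n ℕ.+ 1) ℕ./ 2)))
          ≈⟨ *-congˡ (*-congˡ (*-congˡ q^)) ⟩
        (1# - b * X) * (z * B * t * w n * (p * z⁻¹ * B⁻¹ * (t * X)))
          ≈⟨ solve 9 (λ y z B t w p z⁻¹ B⁻¹ X → y :* (z :* B :* t :* w :* (p :* z⁻¹ :* B⁻¹ :* (t :* X)))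
               := z :* z⁻¹ :* (B :* B⁻¹ :* (t :* t)) :* (X :* (p :* y) :* w))
               refl (1# - b * X) z B t (w n) p z⁻¹ B⁻¹ X ⟩
        z * z⁻¹ * (B * B⁻¹ * (t * t)) * (X * (p * (1# - b * X)) * w n)
          ≈⟨ *-cong (*-cong (inverseʳ _ _) (powers n))
               (*-congʳ (trans (*-congˡ (poch-sucˡ b q n)) (sym (*-assoc _ _ _)))) ⟩
        1# * σ n * (X * (1# - b) * poch (b * q) q n * w n)
          ≈⟨ *-cong (*-identityˡ _) (inverseʳ _ (prefactor#0 n)) ⟩
        σ n * 1#
          ≈⟨ *-identityʳ _ ⟩
        σ n ∎
        where
        X = q ^ n
        z = poch q/b q n
        z⁻¹ = inverse z ([q/b]ₙ#0 n)
        B = (- b) ^ n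
        B⁻¹ = b⁻¹ ^ n
        t = q ^ triangular n
        p = poch b q n

        q^ : q ^ (n ℕ.* (n ℕ.+ 1) ℕ./ 2) ≈ t * X
        q^ = trans (^-congʳ q (≡.cong (ℕ._/ 2)
               (≡.trans (≡.cong (n ℕ.*_) (ℕ.+-comm n 1)) (ℕ.*-comm n (suc n)))))
               (q^triangular-suc n)

        powers : ∀ n → (- b) ^ n * b⁻¹ ^ n * (q ^ triangular n * q ^ triangular n) ≈ σ n
        powers zero    = solve 0 (con (+ 1) :* con (+ 1) :* (con (+ 1) :* con (+ 1)) := con (+ 1)) refl
        powers (suc n) = begin
          - b * (- b) ^ n * (b⁻¹ * b⁻¹ ^ n) * (q ^ triangular (suc n) * q ^ triangular (suc n))
            ≈⟨ *-congˡ (*-cong (q^triangular-suc n) (q^triangular-suc n)) ⟩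
          - b * (- b) ^ n * (b⁻¹ * b⁻¹ ^ n) * (q ^ triangular n * q ^ n * (q ^ triangular n * q ^ n))
            ≈⟨ mod₂ (solve 7 (λ b b⁻¹ B B⁻¹ t X s → let 1# = con (+ 1) in
                 :- b :* B :* (b⁻¹ :* B⁻¹) :* (t :* X :* (t :* X)) := :- (X :* X :* s)
                   :+ (:- (X :* X)) :* (B :* B⁻¹ :* (t :* t) :- s)
                   :+ (:- (B :* B⁻¹ :* (t :* X :* (t :* X)))) :* (b :* b⁻¹ :- 1#))
                 refl b b⁻¹ ((- b) ^ n) (b⁻¹ ^ n) (q ^ triangular n) (q ^ n) (σ n)) (powers n) bb⁻¹≈1 ⟩
          σ (suc n) ∎

      -- This is (1 - q²) Uₙ / (1 - q⁴ⁿ⁺²).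
      V : ℕ → Carrier
      V n = prefactor n * (1# + (1# + 1#) * ∑ n (λ i → term (suc i)))

      V-suc : ∀ n → let X = q ^ n in
        (1# - b * q ^ suc n) * V (suc n) ≈ (X * X - b * u * X) * V n + (1# + 1#) * σ (suc n)
      V-suc n = trans (*-congˡ (*-congˡ (+-congˡ (*-congˡ (∑-last n λ i → term (suc i))))))
        (mod₂ (solve 7 (λ y f′ x f S c s → let 1# = con (+ 1) ; 2# = 1# :+ 1# in
            y :* (f′ :* (1# :+ 2# :* (S :+ c))) := x :* (f :* (1# :+ 2# :* S)) :+ 2# :* s
              :+ (1# :+ 2# :* S) :* (y :* f′ :- x :* f)
              :+ 2# :* (y :* (f′ :* c) :- s))
          refl (1# - b * q ^ suc n) (prefactor (suc n)) (q ^ n * q ^ n - b * u * q ^ n) (prefactor n)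
            (∑ n (λ i → term (suc i))) (term (suc n)) (σ (suc n)))
          (prefactor-suc n) (prefactor-term (suc n)))

      V-fractions : ∀ n M → n ℕ.< M → V n ≈ fractions M n
      V-fractions zero (suc M) _ = inverse-unique
        (begin
          (1# - b * 1#) * (1# * 1# * 1# * w 0 * (1# + (1# + 1#) * 0#))
            ≈⟨ solve 2 (λ b w → let 1# = con (+ 1) in
                 (1# :- b :* 1#) :* (1# :* 1# :* 1# :* w :* (1# :+ (1# :+ 1#) :* con (+ 0)))
                   := 1# :* (1# :- b) :* 1# :* w) refl b (w 0) ⟩
          1# * (1# - b) * 1# * w 0
            ≈⟨ inverseʳ _ (prefactor#0 0) ⟩
          1# ∎)
        (begin
          (1# - b * 1#) * (1# * 1# * Q.1/[ 0 ]! * P.1/[ 0 ]! * κ 0 + ∑ M (λ i → α 0 (suc i) * κ (suc i)))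
            ≈⟨ *-congˡ (+-cong (*-congʳ (*-cong (*-congˡ Q.1/!-0) P.1/!-0))
                 (∑-zero M {λ i → α 0 (suc i) * κ (suc i)} λ i _ → annihilateˡ (α-> (s≤s z≤n)))) ⟩
          (1# - b * 1#) * (1# * 1# * 1# * 1# * κ 0 + 0#)
            ≈⟨ solve 2 (λ x k → let 1# = con (+ 1) in
                 x :* (1# :* 1# :* 1# :* 1# :* k :+ con (+ 0)) := x :* k) refl (1# - b * 1#) (κ 0) ⟩
          (1# - b * 1#) * κ 0
            ≈⟨ inverseʳ _ (1-bqⁱ#0 0) ⟩
          1# ∎)
      V-fractions (suc n) M 1+n<M = *-cancelˡ-# (1-bqⁱ#0 (suc n)) (trans (V-suc n)
        (trans (+-congʳ (*-congˡ (V-fractions n M (ℕ.<-trans (ℕ.n<1+n n) 1+n<M))))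
          (sym (fractions-suc n M 1+n<M))))

    U-fractions : ∀ n M → n ℕ.< M →
      U base b b#0 den n
        ≈ (1# - q ^ (4 ℕ.* n ℕ.+ 2)) * inverse (1# - q ^ 2) (1-qᵏ#0 1) * ∑ M (λ i → α n i * κ i)
    U-fractions n M n<M = trans (*-congʳ (*-congˡ (inverse-unique (inverseʳ _ _) (begin
        q ^ n * (1# - b) * (1# - q ^ 2) * poch (b * q) q n * (i₂ * w n)
          ≈⟨ solve 6 (λ X y x p i w →
               X :* y :* x :* p :* (i :* w) := x :* i :* (X :* y :* p :* w)) refl _ _ _ _ _ _ ⟩
        (1# - q ^ 2) * i₂ * (q ^ n * (1# - b) * poch (b * q) q n * w n)
          ≈⟨ *-cong (inverseʳ _ _) (inverseʳ _ (prefactor#0 n)) ⟩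
        1# * 1#
          ≈⟨ *-identityˡ 1# ⟩
        1# ∎))))
      (trans (solve 7 (λ y z B t i w s →
                 y :* z :* B :* t :* (i :* w) :* s := y :* i :* (z :* B :* t :* w :* s))
               refl _ _ _ _ _ _ _)
        (*-congˡ (V-fractions n M n<M)))
      where
      i₂ = inverse (1# - q ^ 2) (1-qᵏ#0 1)

  -- The even part in b, the exchange of sums and the Bailey relation

  module BaileyPair {q : Carrier} (base : IsBase q)
                    {b : Carrier} {b#0 : b # 0#} (nz : NoDenominatorVanishes q b b#0)
                    (2#0 : 1# + 1# # 0#) where
    open Coefficients base
    open BaileySum base
    open NoDenominatorVanishes nz

    private
      module U⁺ = UExpansion base b#0 at-b
      module U⁻ = UExpansion base (-#0 b#0) at-minus-b

      ½ i₂ : Carrier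
      ½ = 1# / (1# + 1#) ⟨ 2#0 ⟩
      i₂ = inverse (1# - q ^ 2) (1-qᵏ#0 1)

      κ : ℕ → Carrier
      κ i = ½ * U⁺.κ i + ½ * U⁻.κ i

      κ-inverse : ∀ i → (1# - b ^ 2 * q² ^ i) * κ i ≈ 1#
      κ-inverse i = trans (*-congʳ (+-congˡ (-‿cong (*-congˡ (square-^ q i))))) (mod₃
        (solve 5 (λ h b Y k l → let 1# = con (+ 1) in
            (1# :- b :* (b :* 1#) :* (Y :* Y)) :* (1# :* h :* k :+ 1# :* h :* l)
              := 1# :+ h :* (1# :+ b :* Y) :* ((1# :- b :* Y) :* k :- 1#)
                    :+ h :* (1# :- b :* Y) :* ((1# :- :- b :* Y) :* l :- 1#)
                    :+ 1# :* ((1# :+ 1#) :* h :- 1#))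
          refl (inverse (1# + 1#) 2#0) b (q ^ i) (U⁺.κ i) (U⁻.κ i))
        (inverseʳ _ (U⁺.1-bqⁱ#0 i)) (inverseʳ _ (U⁻.1-bqⁱ#0 i)) (inverseʳ _ 2#0))

      module PF = F.PartialFractions (b ^ 2) κ κ-inverse

      U₁-fractions : ∀ j M → j ℕ.< M →
        U₁ base nz 2#0 j ≈ (1# - q ^ (4 ℕ.* j ℕ.+ 2)) * i₂ * ∑ M (λ i → α j i * κ i)
      U₁-fractions j M j<M = begin
        U₁ base nz 2#0 j
          ≈⟨ +-cong (*-congˡ (U⁺.U-fractions j M j<M)) (*-congˡ (U⁻.U-fractions j M j<M)) ⟩
        ½ * (y * S⁺) + ½ * (y * S⁻)
          ≈⟨ solve 4 (λ h y s t → h :* (y :* s) :+ h :* (y :* t) := y :* (h :* s :+ h :* t))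
               refl ½ y S⁺ S⁻ ⟩
        y * (½ * S⁺ + ½ * S⁻)
          ≈⟨ *-congˡ (∑-linear M ½ ½ (λ i → α j i * U⁺.κ i) (λ i → α j i * U⁻.κ i)) ⟨
        y * ∑ M (λ i → ½ * (α j i * U⁺.κ i) + ½ * (α j i * U⁻.κ i))
          ≈⟨ *-congˡ (∑-cong M λ i _ → solve 4 (λ h a k l →
                 h :* (a :* k) :+ h :* (a :* l) := a :* (h :* k :+ h :* l))
               refl ½ (α j i) (U⁺.κ i) (U⁻.κ i)) ⟩
        y * ∑ M (λ i → α j i * κ i) ∎
        where
        y = (1# - q ^ (4 ℕ.* j ℕ.+ 2)) * i₂
        S⁺ = ∑ M λ i → α j i * U⁺.κ i
        S⁻ = ∑ M λ i → α j i * U⁻.κ i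

      q^[4j+2] : ∀ j → q ^ (4 ℕ.* j ℕ.+ 2) ≈ q * q * (q ^ j * q ^ j * (q ^ j * q ^ j))
      q^[4j+2] j = begin
        q ^ (4 ℕ.* j ℕ.+ 2)                        ≈⟨ ^-homo-* q (4 ℕ.* j) 2 ⟩
        q ^ (4 ℕ.* j) * q ^ 2                      ≈⟨ *-congʳ (^-congʳ q (ℕ.*-comm 4 j)) ⟩
        q ^ (j ℕ.* 4) * q ^ 2                      ≈⟨ *-congʳ (^-assocʳ q j 4) ⟨
        (q ^ j) ^ 4 * q ^ 2                        ≈⟨ solve 2 (λ q Y → let 1# = con (+ 1) in
                                                       Y :* (Y :* (Y :* (Y :* 1#))) :* (q :* (q :* 1#))
                                                         := q :* q :* (Y :* Y :* (Y :* Y))) refl q (q ^ j) ⟩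
        q * q * (q ^ j * q ^ j * (q ^ j * q ^ j))  ∎

      weight : ℕ → ℕ → Carrier
      weight n j = inverse (poch q² q² (n ℕ.∸ j) * poch (q² * q²) q² (n ℕ.+ j))
        (*#0 ([q²]ₙ#0 base (n ℕ.∸ j)) ([q⁴]ₙ#0 base (n ℕ.+ j)))

      -- (1 - q²) (q⁴;q²)ₙ₊ⱼ = (q²;q²)ₙ₊ⱼ₊₁, so the 1/(1 - q²) of Uⱼ completes the second factorial
      -- to one that starts at q².
      weight-split : ∀ {n j} → j ℕ.≤ n →
        i₂ * weight n j ≈ P.1/[ n ∸ j ]! * P.1/[ suc (n ℕ.+ j) ]!
      weight-split {n} {j} j≤n = inverse-unique {x = (1# - q²) * (A * B)}
        (trans (solve 4 (λ y ab i k → y :* ab :* (i :* k) := y :* i :* (ab :* k)) refl _ _ _ _)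
          (trans (*-cong (inverseʳ _ _) (inverseʳ _ _)) (*-identityˡ 1#)))
        (begin
          (1# - q²) * (A * B) * (P.1/[ n ∸ j ]! * P.1/[ suc (n ℕ.+ j) ]!)
            ≈⟨ solve 5 (λ y a b k l → y :* (a :* b) :* (k :* l) := a :* k :* (y :* b :* l)) refl _ _ _ _ _ ⟩
          A * P.1/[ n ∸ j ]! * ((1# - q²) * B * P.1/[ suc (n ℕ.+ j) ]!)
            ≈⟨ *-cong (*-congˡ (reflexive (P.1/∸!-∸ j≤n))) (*-congʳ (sym (poch-sucˡ q² q² (n ℕ.+ j)))) ⟩
          A * P.1/[ n ℕ.∸ j ]! * (poch q² q² (suc (n ℕ.+ j)) * P.1/[ suc (n ℕ.+ j) ]!)
            ≈⟨ *-cong (inverseʳ _ _) (inverseʳ _ _) ⟩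
          1# * 1#
            ≈⟨ *-identityˡ 1# ⟩
          1# ∎)
        where
        A = poch q² q² (n ℕ.∸ j)
        B = poch (q² * q²) q² (n ℕ.+ j)

      -- Since α j i = 0 for i > j, each U₁ with j ≤ n may be expanded over all i ≤ n. The double
      -- sum then runs over a square, and each column is a multiple of a sum evaluated by
      -- `∑-summand`.
      bailey-sum : ∀ n → poch (- q) q (2 ℕ.* n) * ∑ (suc n) (λ j → U₁ base nz 2#0 j * weight n j)
        ≈ PF.fractions (suc n) n
      bailey-sum n = begin
        D * ∑ M (λ j → U₁ base nz 2#0 j * weight n j)
          ≈⟨ *-congˡ (∑-cong M λ { j (s≤s j≤n) → row j j≤n }) ⟩
        D * ∑ M (λ j → ∑ M λ i → κ i * summand i n j)
          ≈⟨ *-congˡ (∑-swap M M λ j i → κ i * summand i n j) ⟩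
        D * ∑ M (λ i → ∑ M λ j → κ i * summand i n j)
          ≈⟨ ∑-*ˡ M D (λ i → ∑ M λ j → κ i * summand i n j) ⟩
        ∑ M (λ i → D * ∑ M λ j → κ i * summand i n j)
          ≈⟨ ∑-cong M (λ { i (s≤s i≤n) → column i i≤n }) ⟩
        ∑ M (λ i → F.residue n i * κ i) ∎
        where
        M = suc n
        D = poch (- q) q (2 ℕ.* n)

        row : ∀ j → j ℕ.≤ n → U₁ base nz 2#0 j * weight n j ≈ ∑ M λ i → κ i * summand i n j
        row j j≤n = begin
          U₁ base nz 2#0 j * k
            ≈⟨ *-congʳ (U₁-fractions j M (s≤s j≤n)) ⟩
          (1# - q ^ (4 ℕ.* j ℕ.+ 2)) * i₂ * S * k
            ≈⟨ solve 4 (λ y i s k → y :* i :* s :* k := y :* (i :* k) :* s) refl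
                 (1# - q ^ (4 ℕ.* j ℕ.+ 2)) i₂ S k ⟩
          (1# - q ^ (4 ℕ.* j ℕ.+ 2)) * (i₂ * k) * S
            ≈⟨ *-congʳ (*-cong (+-congˡ (-‿cong (q^[4j+2] j))) (weight-split j≤n)) ⟩
          y * (r * l) * S
            ≈⟨ ∑-*ˡ M (y * (r * l)) (λ i → α j i * κ i) ⟩
          ∑ M (λ i → y * (r * l) * (α j i * κ i))
            ≈⟨ ∑-cong M (λ i _ → solve 5 (λ y r l a k →
                   y :* (r :* l) :* (a :* k) := k :* (y :* a :* r :* l))
                 refl y r l (α j i) (κ i)) ⟩
          ∑ M (λ i → κ i * summand i n j) ∎
          where
          k = weight n j
          S = ∑ M λ i → α j i * κ i
          y = 1# - q * q * (q ^ j * q ^ j * (q ^ j * q ^ j))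
          r = P.1/[ n ∸ j ]!
          l = P.1/[ suc (n ℕ.+ j) ]!

        column : ∀ i → i ℕ.≤ n → D * ∑ M (λ j → κ i * summand i n j) ≈ F.residue n i * κ i
        column i i≤n = begin
          D * ∑ M (λ j → κ i * summand i n j)
            ≈⟨ *-congˡ (∑-*ˡ M (κ i) (summand i n)) ⟨
          D * (κ i * ∑ M (summand i n))
            ≈⟨ solve 3 (λ d k s → d :* (k :* s) := d :* s :* k) refl D (κ i) (∑ M (summand i n)) ⟩
          D * ∑ M (summand i n) * κ i
            ≈⟨ *-congʳ (≡.subst
                 (λ n → poch (- q) q (2 ℕ.* n) * ∑ (suc n) (summand i n) ≈ F.residue n i)
                 (ℕ.m∸n+n≡m i≤n) (∑-summand i (n ℕ.∸ i))) ⟩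
          F.residue n i * κ i
            ∎

      q^n[n-2] : ℕ → Carrier
      q^n[n-2] n = q ^⟨ q#0 ⟩ (+ n ℤ.* (+ n ℤ.- + 2))

      -- The exponent n(n-2) grows by 2n - 1. It is negative only at n = 1, so the steps from 0 and
      -- from 1 are computed directly; from n = 2 on it is a natural number.
      q^n[n-2]-suc : ∀ n → q^n[n-2] (suc n) ≈ q ^ n * q ^ n * u * q^n[n-2] n
      q^n[n-2]-suc zero = solve 1 (λ u → let 1# = con (+ 1) in u :* 1# := 1# :* 1# :* u :* 1#) refl u
      q^n[n-2]-suc (suc zero) = mod₁
        (solve 2 (λ q u → let 1# = con (+ 1) in
          1# := q :* 1# :* (q :* 1#) :* u :* (u :* 1#) :+ (:- (q :* u :+ 1#)) :* (q :* u :- 1#)) refl q u)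
        qu≈1
      q^n[n-2]-suc (suc (suc k)) = begin
        q^n[n-2] (3 ℕ.+ k)
          ≈⟨ q^n[n-2]-≥2 (suc k) ⟩
        q ^ (suc k ℕ.+ (2 ℕ.+ k) ℕ.* suc k)
          ≈⟨ trans (^-homo-* q (suc k) _)
               (*-congˡ (trans (^-congʳ q (ℕ.*-suc (2 ℕ.+ k) k)) (^-homo-* q (2 ℕ.+ k) _))) ⟩
        q ^ suc k * (q ^ (2 ℕ.+ k) * q ^ ((2 ℕ.+ k) ℕ.* k))
          ≈⟨ mod₁ (solve 4 (λ q u Y t → Y :* (q :* Y :* t) := q :* Y :* (q :* Y) :* u :* t
                 :+ (:- (Y :* (q :* Y :* t))) :* (q :* u :- con (+ 1)))
               refl q u (q ^ suc k) (q ^ ((2 ℕ.+ k) ℕ.* k))) qu≈1 ⟩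
        q ^ (2 ℕ.+ k) * q ^ (2 ℕ.+ k) * u * q ^ ((2 ℕ.+ k) ℕ.* k)
          ≈⟨ *-congˡ (q^n[n-2]-≥2 k) ⟨
        q ^ (2 ℕ.+ k) * q ^ (2 ℕ.+ k) * u * q^n[n-2] (2 ℕ.+ k) ∎
        where
        q^n[n-2]-≥2 : ∀ k → q^n[n-2] (2 ℕ.+ k) ≈ q ^ ((2 ℕ.+ k) ℕ.* k)
        q^n[n-2]-≥2 k = reflexive (≡.cong (q ^⟨ q#0 ⟩_) (≡.sym (ℤ.pos-* (2 ℕ.+ k) k)))

      -- In the partial fractions p = q², c = q⁻¹ and B = b², so the exponent of q is n(n-1) - n =
      -- n(n-2). This fixes the choice of c.
      numerator-closed : ∀ n → (- (b ^ 2)) ^ n * q^n[n-2] n ≈ PF.numerator n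
      numerator-closed zero    = *-identityˡ 1#
      numerator-closed (suc n) = begin
        - (b ^ 2) * (- (b ^ 2)) ^ n * q^n[n-2] (suc n)
          ≈⟨ *-congˡ (q^n[n-2]-suc n) ⟩
        - (b ^ 2) * (- (b ^ 2)) ^ n * (q ^ n * q ^ n * u * q^n[n-2] n)
          ≈⟨ solve 5 (λ B C X u t → :- B :* C :* (X :* u :* t) := :- (X :* u :* B) :* (C :* t))
               refl (b ^ 2) ((- (b ^ 2)) ^ n) (q ^ n * q ^ n) u (q^n[n-2] n) ⟩
        - (q ^ n * q ^ n * u * b ^ 2) * ((- (b ^ 2)) ^ n * q^n[n-2] n)
          ≈⟨ *-cong (-‿cong (*-congʳ (*-congʳ (sym (square-^ q n))))) (numerator-closed n) ⟩
        PF.numerator (suc n) ∎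

    -- Both sides are multiplied by the denominator of U₂. Its factor (-q;q)₂ₙ turns the Bailey sum
    -- into the fractions, and (b²;q²)ₙ₊₁ turns these into the numerator of U₂.
    isBaileyPair : IsBaileyPair q² q² ([q²]ₙ#0 base) ([q⁴]ₙ#0 base) (U₁ base nz 2#0) (U₂ base nz)
    isBaileyPair n = *-cancelˡ-# h (begin
      D * B * (N * inverse (D * B) h)     ≈⟨ solve 3 (λ d n i → d :* (n :* i) := n :* (d :* i))
                                               refl (D * B) N (inverse (D * B) h) ⟩
      N * (D * B * inverse (D * B) h)     ≈⟨ *-congˡ (inverseʳ _ h) ⟩
      N * 1#                              ≈⟨ *-identityʳ N ⟩
      N                                   ≈⟨ numerator-closed n ⟩
      PF.numerator n                      ≈⟨ PF.fractions-closed n (suc n) (ℕ.n<1+n n) ⟨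
      B * PF.fractions (suc n) n          ≈⟨ *-congˡ (bailey-sum n) ⟨
      B * (D * S)                         ≈⟨ trans (sym (*-assoc _ _ _)) (*-congʳ (*-comm B D)) ⟩
      D * B * S                           ∎)
      where
      D = poch (- q) q (2 ℕ.* n)
      B = poch (b ^ 2) (q ^ 2) (suc n)
      N = (- (b ^ 2)) ^ n * q^n[n-2] n
      S = ∑ (suc n) λ j → U₁ base nz 2#0 j * weight n j
      h = *#0 ([-q]ₙ#0 base (2 ℕ.* n)) ([b²]ₙ₊₁#0 n)

-- The theorem over ℂ

open import Defs

lemma2p4 : (q b : ℂ) (0<∣q∣ : 0ᴿ <ᴿ ‖ q ‖) (∣q∣<1 : ‖ q ‖ <ᴿ 1ᴿ) (b≠0 : b #ᶜ 0ᶜ)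
    (nz : NoDenominatorVanishes q b b≠0) →
    let base = punctured-disc q 0<∣q∣ ∣q∣<1 in
    IsBaileyPair (q ^ 2) (q ^ 2) ([q²]ₙ#0 base) ([q⁴]ₙ#0 base)
    (U₁ base nz 2#0) (U₂ base nz)
lemma2p4 q b 0<∣q∣ ∣q∣<1 b≠0 nz = isBaileyPair
  where
  open QSeriesIdentities ℂ-heytingField
  open BaileyPair (punctured-disc q 0<∣q∣ ∣q∣<1) nz 2#0
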